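{- Let $d>1$ be a constant and let $\mathcal{A}_d$ be any algorithm solving the $(n,d)$-array problem, without recomputation, on a BSP with $p$ processors, where $1<p\le n^{d-1}$, and let $W$ be the maximum number of nodes evaluated by a processor. If $W\le\epsilon n^d$ for an arbitrary constant $\epsilon\in(0,1)$, then the communication complexity of $\mathcal{A}_d$ is \[H_{\mathcal{A}_d}(n,p)=\Omega\!\left(\frac{n^{d-1}}{p^{(d-2)/(d-1)}}+W^{(d-1)/d}\right).\]
   Context: BSP model: $p$ processors, each with an unbounded private local memory, connected by a communication network; computation proceeds in supersteps, each consisting of local computation and message sending (one data word per message) followed by a global synchronization. If $h_i$ is the maximum number of messages sent or received by any processor in superstep $i$, the communication complexity is $H=\sum_i h_i$. The $d$-dimensional array DAG of size $n$ has $n^d$ nodes $\langle i_0,\dots,i_{d-1}\rangle$, $0\le i_k<n$, with an arc from $\langle i_0,\dots,i_k,\dots,i_{d-1}\rangle$ to $\langle i_0,\dots,i_k+1,\dots,i_{d-1}\rangle$ whenever $i_k+1<n$, for each $0\le k<d$. The $(n,d)$-array problem is to evaluate all nodes of this DAG, a node being evaluable by a processor only once the values of all its predecessors are available to it. "Without recomputation" means each node is evaluated exactly once. No assumption is made on initial data placement or on the balance of work. Constants in $\Omega$ may depend on $d$ and $\epsilon$. -}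

module Defs where

open import Data.Nat using (ℕ; zero; suc; _<_; _≤_; _⊔_)
open import Data.Fin using (Fin; toℕ)
open import Data.Fin.Properties using (_≟_)
open import Data.Vec using (Vec; []; _∷_; lookup)
open import Data.List using (List; [_]; map; concatMap; allFin; filter; length; foldr; upTo)
open import Data.Nat.ListAction using (sum)
open import Data.List.Membership.Propositional using (_∈_)
open import Data.List.Relation.Unary.All using (All)
open import Data.Product using (Σ; _×_; ∃-syntax)
open import Data.Sum using (_⊎_)
open import Relation.Binary.PropositionalEquality using (_≡_; _≢_)
open import Relation.Nullary.Decidable using (_×-dec_)
import Data.Nat.Properties as ℕP

Node : ℕ → ℕ → Set
Node n d = Vec (Fin n) d

Arc : {n d : ℕ} → Node n d → Node n d → Set
Arc {n} {d} u v =
  Σ (Fin d) λ k → (toℕ (lookup v k) ≡ suc (toℕ (lookup u k)))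
                × ((j : Fin d) → j ≢ k → lookup u j ≡ lookup v j)

allNodes : (n d : ℕ) → List (Node n d)
allNodes n zero = [ [] ]
allNodes n (suc d) = concatMap (λ i → map (i ∷_) (allNodes n d)) (allFin n)

maxOver : (p : ℕ) → (Fin p → ℕ) → ℕ
maxOver p f = foldr _⊔_ 0 (map f (allFin p))

-- A message: in superstep 'time', processor 'src' sends the value of
-- node 'node' (one data word) to processor 'dst'.
record Msg (n d p : ℕ) : Set where
  constructor msg
  field
    time : ℕ
    src  : Fin p
    dst  : Fin p
    node : Node n d
open Msg public

-- Value of node u is available to processor q during (the local
-- computation / sending phase of) superstep s: either q evaluated u
-- itself in a superstep ≤ s, or q received it in an earlier superstep.
Avail : {n d p : ℕ} → (Node n d → Fin p) → (Node n d → ℕ) → List (Msg n d p)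
      → Fin p → ℕ → Node n d → Set
Avail proc step msgs q s u =
  (proc u ≡ q × step u ≤ s)
  ⊎ (∃[ m ] (m ∈ msgs × dst m ≡ q × node m ≡ u × time m < s))

-- An execution of a BSP algorithm with p processors on the (n,d)-array
-- problem without recomputation: every node is evaluated exactly once,
-- by processor 'proc v' in superstep 'step v'.
record Execution (n d p : ℕ) : Set where
  field
    S     : ℕ
    proc  : Node n d → Fin p
    step  : Node n d → ℕ
    msgs  : List (Msg n d p)
    step<S   : (v : Node n d) → step v < S
    msgs<S   : All (λ m → time m < S) msgs
    noSelf   : All (λ m → src m ≢ dst m) msgs
    sendOK   : All (λ m → Avail proc step msgs (src m) (time m) (node m)) msgs
    evalOK   : (u v : Node n d) → Arc u v → Avail proc step msgs (proc v) (step v) u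

  load : Fin p → ℕ
  load q = length (filter (λ v → proc v ≟ q) (allNodes n d))

  W : ℕ
  W = maxOver p load

  sent recv : Fin p → ℕ → ℕ
  sent q s = length (filter (λ m → (src m ≟ q) ×-dec (time m ℕP.≟ s)) msgs)
  recv q s = length (filter (λ m → (dst m ≟ q) ×-dec (time m ℕP.≟ s)) msgs)

  h : ℕ → ℕ
  h s = maxOver p (λ q → sent q s ⊔ recv q s)

  H : ℕ
  H = sum (map h (upTo S))

module Submission where

-- Call an arc crossing if its ends are evaluated by different processors: the value of its tail is then sent
-- between the evaluations of its two ends. A Poincaré inequality in boxes turns a mixture of processors into
-- crossing arcs. A processor with a large load has many crossing arcs in the grid cut into boxes of about twice
-- its load, which is the second term. For the first term take cubes of side m, of which the grid contains about
-- p diagonal lines. If most of them have no majority processor, the total number of messages is large. Otherwise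
-- some diagonal meets few such cubes; every other cube on it can be grown until its majority is just lost, and
-- then has many crossing arcs at a single processor. Cubes that follow each other on a diagonal are evaluated one
-- after the other, so these communications add up.

open import Defs
open import Data.Bool.Base using (Bool; true; false; if_then_else_)
import Data.Bool.Properties as Boolₚ
open import Data.Fin.Base as Fin using (Fin; toℕ)
open import Data.Fin.Properties using (_≟_; any?)
open import Data.List.Base using (List; []; _∷_; [_]; _++_; map; concatMap; filter; length; foldr; upTo; allFin; tabulate)
open import Data.List.Membership.Propositional using (_∈_; find)
open import Data.List.Membership.Propositional.Properties using (∈-map⁻; ∈-concatMap⁻; ∈-upTo⁻; ∈-upTo⁺; ∈-allFin)
open import Data.List.Properties using (map-cong; map-∘; map-upTo; length-upTo; map-tabulate; length-tabulate; map-++)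
import Data.List.Relation.Unary.All as ListAll
open import Data.List.Relation.Unary.Any using (here; there)
open import Data.Nat hiding (_≟_)
open import Data.Nat.DivMod using (_/_; _%_; m≡m%n+[m/n]*n; m%n<n)
open import Data.Nat.Induction using (<-wellFounded; Acc; acc)
open import Data.Nat.ListAction using (sum)
open import Data.Nat.ListAction.Properties using (sum-++)
open import Data.Nat.Properties hiding (_≟_)
import Data.Nat.Properties as ℕₚ
open import Data.Nat.Tactic.RingSolver using (solve-∀)
open import Data.Product using (_×_; _,_; proj₁; proj₂; ∃-syntax)
open import Data.Sum using (_⊎_; inj₁; inj₂)
open import Data.Vec.Base as Vec using (Vec; []; _∷_; replicate; zipWith; updateAt)
open import Data.Vec.Properties using (≡-dec; zipWith-identityˡ; zipWith-comm; zipWith-replicate)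
open import Data.Vec.Relation.Binary.Pointwise.Inductive as Pointwise using (Pointwise; []; _∷_)
open import Data.Vec.Relation.Unary.All using (All; []; _∷_)
open import Function.Base using (_∘_; id; const)
open import Relation.Binary.Definitions using (DecidableEquality)
open import Relation.Binary.PropositionalEquality hiding ([_])
open import Relation.Nullary using (Dec; yes; no; does; ¬_; contradiction; ¬?)
open import Relation.Nullary.Decidable using (_×-dec_)
open import Relation.Unary using (Decidable)

-- `H` adds up the maximal traffic of the supersteps, and neither work nor traffic need be balanced.
-- So `H` is bounded from below only by the number of messages divided by `p` or by the traffic of a
-- single processor, and over a time window by the traffic of one processor in that window. If
-- `(n/m)^(d-1)` is about `p`, both alternatives give `n * m^(d-2)`, which is the first term: either
-- about `n^d / m` crossing arcs are shared by `p` processors, or `n/m` windows in turn carry about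
-- `m^(d-1)` crossings each. A cube owned by one processor needs no communication, hence the growth.
-- It must end if `W` is a small fraction of `n^d`. If `W` is not small, the hypothesis on ε still
-- leaves a constant fraction of the nodes to the others, and the heavy processor alone has about
-- `n^(d-1)` crossings, which covers both terms. Grown cubes have unequal sides and end anywhere, so
-- no fixed tiling serves: cubes are taken at all positions, and the diagonals are averaged over
-- their starting points.

private variable
  A B : Set
  d p : ℕ

-- Finite sums

∑ : List A → (A → ℕ) → ℕ
∑ xs f = sum (map f xs)

∑-cong : ∀ (xs : List A) {f g : A → ℕ} → (∀ x → f x ≡ g x) → ∑ xs f ≡ ∑ xs g
∑-cong xs eq = cong sum (map-cong eq xs)

∑-mono : ∀ (xs : List A) {f g : A → ℕ} → (∀ {x} → x ∈ xs → f x ≤ g x) → ∑ xs f ≤ ∑ xs g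
∑-mono []       le = z≤n
∑-mono (x ∷ xs) le = +-mono-≤ (le (here refl)) (∑-mono xs (le ∘ there))

∑-+ : ∀ (xs : List A) (f g : A → ℕ) → ∑ xs (λ x → f x + g x) ≡ ∑ xs f + ∑ xs g
∑-+ []       f g = refl
∑-+ (x ∷ xs) f g rewrite ∑-+ xs f g = shuffle (f x) (g x) (∑ xs f) (∑ xs g)
  where
  shuffle : ∀ a b s t → (a + b) + (s + t) ≡ (a + s) + (b + t)
  shuffle = solve-∀

∑-*ˡ : ∀ (xs : List A) c (f : A → ℕ) → ∑ xs (λ x → c * f x) ≡ c * ∑ xs f
∑-*ˡ []       c f = sym (*-zeroʳ c)
∑-*ˡ (x ∷ xs) c f rewrite ∑-*ˡ xs c f = sym (*-distribˡ-+ c (f x) (∑ xs f))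

∑-*ʳ : ∀ (xs : List A) c (f : A → ℕ) → ∑ xs (λ x → f x * c) ≡ ∑ xs f * c
∑-*ʳ xs c f = trans (∑-cong xs (λ x → *-comm (f x) c)) (trans (∑-*ˡ xs c f) (*-comm c _))

∑-const : ∀ (xs : List A) c → ∑ xs (const c) ≡ length xs * c
∑-const []       c = refl
∑-const (x ∷ xs) c = cong (c +_) (∑-const xs c)

∑-swap : ∀ (xs : List A) (ys : List B) (f : A → B → ℕ) →
  ∑ xs (λ x → ∑ ys (f x)) ≡ ∑ ys (λ y → ∑ xs (λ x → f x y))
∑-swap []       ys f = sym (trans (∑-const ys 0) (*-zeroʳ (length ys)))
∑-swap (x ∷ xs) ys f rewrite ∑-swap xs ys f = sym (∑-+ ys (f x) _)

∑-member : ∀ {xs : List A} {x} (f : A → ℕ) → x ∈ xs → f x ≤ ∑ xs f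
∑-member f (here refl) = m≤m+n _ _
∑-member f (there x∈)  = ≤-trans (∑-member f x∈) (m≤n+m _ _)

∑-map : ∀ (g : A → B) (xs : List A) (f : B → ℕ) → ∑ (map g xs) f ≡ ∑ xs (f ∘ g)
∑-map g xs f = cong sum (sym (map-∘ xs))

∑-concatMap : ∀ (g : A → List B) (xs : List A) (f : B → ℕ) →
  ∑ (concatMap g xs) f ≡ ∑ xs (λ x → ∑ (g x) f)
∑-concatMap g []       f = refl
∑-concatMap g (x ∷ xs) f = begin
  sum (map f (g x ++ concatMap g xs))             ≡⟨ cong sum (map-++ f (g x) _) ⟩
  sum (map f (g x) ++ map f (concatMap g xs))     ≡⟨ sum-++ (map f (g x)) _ ⟩
  ∑ (g x) f + ∑ (concatMap g xs) f                ≡⟨ cong (∑ (g x) f +_) (∑-concatMap g xs f) ⟩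
  ∑ (g x) f + ∑ xs (λ y → ∑ (g y) f)              ∎
  where open ≡-Reasoning

∑-upTo-const : ∀ n c → ∑ (upTo n) (const c) ≡ n * c
∑-upTo-const n c = trans (∑-const (upTo n) c) (cong (_* c) (length-upTo n))

∑-upTo-suc : ∀ n (f : ℕ → ℕ) → ∑ (upTo (suc n)) f ≡ f 0 + ∑ (upTo n) (f ∘ suc)
∑-upTo-suc n f = trans (cong sum (map-upTo f (suc n))) (cong (λ xs → f 0 + sum xs) (sym (map-upTo (f ∘ suc) n)))

∑-upTo-+ : ∀ m n (f : ℕ → ℕ) → ∑ (upTo (m + n)) f ≡ ∑ (upTo m) f + ∑ (upTo n) (λ i → f (m + i))
∑-upTo-+ zero    n f = refl
∑-upTo-+ (suc m) n f rewrite ∑-upTo-suc (m + n) f | ∑-upTo-suc m f | ∑-upTo-+ m n (f ∘ suc) =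
  sym (+-assoc (f 0) _ _)

∑-upTo-window : ∀ {k n} l (f : ℕ → ℕ) → k + l ≤ n → ∑ (upTo l) (λ i → f (k + i)) ≤ ∑ (upTo n) f
∑-upTo-window {k} {n} l f k+l≤n = begin
  ∑ (upTo l) (λ i → f (k + i))                      ≤⟨ m≤n+m _ _ ⟩
  ∑ (upTo k) f + ∑ (upTo l) (λ i → f (k + i))       ≡⟨ ∑-upTo-+ k l f ⟨
  ∑ (upTo (k + l)) f                                ≤⟨ m≤m+n _ _ ⟩
  ∑ (upTo (k + l)) f + _                            ≡⟨ ∑-upTo-+ (k + l) (n ∸ (k + l)) f ⟨
  ∑ (upTo (k + l + (n ∸ (k + l)))) f                ≡⟨ cong (λ z → ∑ (upTo z) f) (m+[n∸m]≡n k+l≤n) ⟩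
  ∑ (upTo n) f                                      ∎
  where open ≤-Reasoning

∑-allFin : ∀ n (f : ℕ → ℕ) → ∑ (allFin n) (f ∘ toℕ) ≡ ∑ (upTo n) f
∑-allFin zero    f = refl
∑-allFin (suc n) f = begin
  f 0 + ∑ (tabulate {n = n} Fin.suc) (f ∘ toℕ)          ≡⟨ cong (λ xs → f 0 + ∑ xs (f ∘ toℕ)) (sym (map-tabulate {n = n} id Fin.suc)) ⟩
  f 0 + ∑ (map Fin.suc (allFin n)) (f ∘ toℕ)    ≡⟨ cong (f 0 +_) (∑-map Fin.suc (allFin n) (f ∘ toℕ)) ⟩
  f 0 + ∑ (allFin n) (f ∘ suc ∘ toℕ)            ≡⟨ cong (f 0 +_) (∑-allFin n (f ∘ suc)) ⟩
  f 0 + ∑ (upTo n) (f ∘ suc)                    ≡⟨ ∑-upTo-suc n f ⟨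
  ∑ (upTo (suc n)) f                            ∎
  where open ≡-Reasoning

𝟙 : ∀ {P : Set} → Dec P → ℕ
𝟙 P? = if does P? then 1 else 0

𝟙-yes : ∀ {P : Set} (P? : Dec P) → P → 𝟙 P? ≡ 1
𝟙-yes (yes _) _ = refl
𝟙-yes (no ¬p) p = contradiction p ¬p

𝟙-no : ∀ {P : Set} (P? : Dec P) → ¬ P → 𝟙 P? ≡ 0
𝟙-no (yes p) ¬p = contradiction p ¬p
𝟙-no (no _)  _  = refl

𝟙≤1 : ∀ {P : Set} (P? : Dec P) → 𝟙 P? ≤ 1
𝟙≤1 (yes _) = ≤-refl
𝟙≤1 (no _)  = z≤n

length-filter : ∀ {P : A → Set} (P? : Decidable P) xs → length (filter P? xs) ≡ ∑ xs (𝟙 ∘ P?)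
length-filter P? []       = refl
length-filter P? (x ∷ xs) with does (P? x)
... | false = length-filter P? xs
... | true  = cong suc (length-filter P? xs)

-- Boxes

-- Boxes are anchored at the origin and placed by `⊕`. Points have entries in `ℕ` rather than in
-- `Fin n`, so that translations carry no bounds.
box : Vec ℕ d → List (Vec ℕ d)
box []       = [ [] ]
box (l ∷ ls) = concatMap (λ i → map (i ∷_) (box ls)) (upTo l)

infixl 6 _⊕_
_⊕_ : Vec ℕ d → Vec ℕ d → Vec ℕ d
_⊕_ = zipWith _+_

cube : (d r : ℕ) → List (Vec ℕ d)
cube d r = box (replicate d r)

∑-box-∷ : ∀ l (ls : Vec ℕ d) (f : Vec ℕ (suc d) → ℕ) →
  ∑ (box (l ∷ ls)) f ≡ ∑ (upTo l) (λ i → ∑ (box ls) (λ u → f (i ∷ u)))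
∑-box-∷ l ls f = trans (∑-concatMap (λ i → map (i ∷_) (box ls)) (upTo l) f)
                       (∑-cong (upTo l) (λ i → ∑-map (i ∷_) (box ls) f))

∑-one : ∀ (xs : List A) → ∑ xs (const 1) ≡ length xs
∑-one xs = trans (∑-const xs 1) (*-identityʳ _)

length-box-∷ : ∀ l (ls : Vec ℕ d) → length (box (l ∷ ls)) ≡ l * length (box ls)
length-box-∷ l ls = begin
  length (box (l ∷ ls))                                   ≡⟨ ∑-one (box (l ∷ ls)) ⟨
  ∑ (box (l ∷ ls)) (const 1)                              ≡⟨ ∑-box-∷ l ls (const 1) ⟩
  ∑ (upTo l) (λ _ → ∑ (box ls) (const 1))                 ≡⟨ ∑-upTo-const l _ ⟩
  l * ∑ (box ls) (const 1)                                ≡⟨ cong (l *_) (∑-one (box ls)) ⟩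
  l * length (box ls)                                     ∎
  where open ≡-Reasoning

length-cube : ∀ d r → length (cube d r) ≡ r ^ d
length-cube zero    r = refl
length-cube (suc d) r = trans (length-box-∷ r (replicate d r)) (cong (r *_) (length-cube d r))

length-box-≥ : ∀ {r} (ls : Vec ℕ d) → All (r ≤_) ls → r ^ d ≤ length (box ls)
length-box-≥ []       []       = ≤-refl
length-box-≥ (l ∷ ls) (p ∷ ps) = ≤-trans (*-mono-≤ p (length-box-≥ ls ps)) (≤-reflexive (sym (length-box-∷ l ls)))

∈-box⁻ : ∀ (ls : Vec ℕ d) {u} → u ∈ box ls → Pointwise _<_ u ls
∈-box⁻ []       (here refl) = []
∈-box⁻ (l ∷ ls) u∈ with find (∈-concatMap⁻ (λ i → map (i ∷_) (box ls)) {xs = upTo l} u∈)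
... | i , i∈ , u∈′ with ∈-map⁻ (i ∷_) u∈′
... | v , v∈ , refl = ∈-upTo⁻ i∈ ∷ ∈-box⁻ ls v∈

∑-box-window : ∀ {y ms : Vec ℕ d} (ls : Vec ℕ d) (f : Vec ℕ d → ℕ) → Pointwise _≤_ (y ⊕ ls) ms →
  ∑ (box ls) (λ u → f (y ⊕ u)) ≤ ∑ (box ms) f
∑-box-window {y = []}    {[]}     []       f [] = ≤-refl
∑-box-window {y = x ∷ y} {m ∷ ms} (l ∷ ls) f (p ∷ ps) = begin
  ∑ (box (l ∷ ls)) (λ u → f ((x ∷ y) ⊕ u))                                  ≡⟨ ∑-box-∷ l ls _ ⟩
  ∑ (upTo l) (λ i → ∑ (box ls) (λ u → f ((x + i) ∷ (y ⊕ u))))               ≤⟨ ∑-mono (upTo l) (λ {i} _ → ∑-box-window ls (λ u → f ((x + i) ∷ u)) ps) ⟩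
  ∑ (upTo l) (λ i → ∑ (box ms) (λ u → f ((x + i) ∷ u)))                     ≤⟨ ∑-upTo-window l (λ i → ∑ (box ms) (λ u → f (i ∷ u))) p ⟩
  ∑ (upTo m) (λ i → ∑ (box ms) (λ u → f (i ∷ u)))                           ≡⟨ ∑-box-∷ m ms f ⟨
  ∑ (box (m ∷ ms)) f                                                        ∎
  where open ≤-Reasoning

_≟ᵥ_ : DecidableEquality (Vec ℕ d)
_≟ᵥ_ = ≡-dec ℕₚ._≟_

-- Pieces of length `r` are cut off while more than `2 * r` is left, so the remainder never falls
-- below `r` and no divisibility is required. `k` is fuel for the recursion.
∑-split : ∀ {r n} (f g : ℕ → ℕ) → 0 < r →
  (∀ x l → r ≤ l → l ≤ 2 * r → x + l ≤ n → ∑ (upTo l) (λ i → f (x + i)) ≤ ∑ (upTo l) (λ i → g (x + i))) →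
  ∀ k x l → l ≤ k → r ≤ l → x + l ≤ n → ∑ (upTo l) (λ i → f (x + i)) ≤ ∑ (upTo l) (λ i → g (x + i))
∑-split {r} {n} f g 0<r short zero x l l≤k r≤l _ = contradiction (≤-trans 0<r (≤-trans r≤l l≤k)) (λ ())
∑-split {r} {n} f g 0<r short (suc k) x l l≤k r≤l x+l≤n with l ≤? 2 * r
... | yes l≤2r = short x l r≤l l≤2r x+l≤n
... | no  l≰2r = subst (λ z → ∑ (upTo z) (λ i → f (x + i)) ≤ ∑ (upTo z) (λ i → g (x + i))) r+l′≡l (begin
  ∑ (upTo (r + l′)) (λ i → f (x + i))                                             ≡⟨ ∑-upTo-+ r l′ _ ⟩
  ∑ (upTo r) (λ i → f (x + i)) + ∑ (upTo l′) (λ i → f (x + (r + i)))              ≡⟨ cong (∑ (upTo r) (λ i → f (x + i)) +_) (∑-cong (upTo l′) (λ i → cong f (sym (+-assoc x r i)))) ⟩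
  ∑ (upTo r) (λ i → f (x + i)) + ∑ (upTo l′) (λ i → f (x + r + i))                ≤⟨ +-mono-≤ first rest ⟩
  ∑ (upTo r) (λ i → g (x + i)) + ∑ (upTo l′) (λ i → g (x + r + i))                ≡⟨ cong (∑ (upTo r) (λ i → g (x + i)) +_) (∑-cong (upTo l′) (λ i → cong g (+-assoc x r i))) ⟩
  ∑ (upTo r) (λ i → g (x + i)) + ∑ (upTo l′) (λ i → g (x + (r + i)))              ≡⟨ ∑-upTo-+ r l′ _ ⟨
  ∑ (upTo (r + l′)) (λ i → g (x + i))                                             ∎)
  where
  open ≤-Reasoning
  l′ = l ∸ r
  r+l′≡l : r + l′ ≡ l
  r+l′≡l = m+[n∸m]≡n r≤l
  2r<l : 2 * r < l
  2r<l = ≰⇒> l≰2r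
  r≤l′ : r ≤ l′
  r≤l′ = +-cancelˡ-≤ r r l′ (subst₂ _≤_ (cong (r +_) (+-identityʳ r)) (sym r+l′≡l) (<⇒≤ 2r<l))
  l′≤k : l′ ≤ k
  l′≤k = s≤s⁻¹ (≤-trans (subst (suc l′ ≤_) r+l′≡l (+-monoˡ-≤ l′ 0<r)) l≤k)
  fits : x + r + l′ ≤ n
  fits = subst (_≤ n) (trans (cong (x +_) (sym r+l′≡l)) (sym (+-assoc x r l′))) x+l≤n
  first : ∑ (upTo r) (λ i → f (x + i)) ≤ ∑ (upTo r) (λ i → g (x + i))
  first = short x r ≤-refl (m≤m+n r _) (≤-trans (m≤m+n (x + r) l′) fits)
  rest : ∑ (upTo l′) (λ i → f (x + r + i)) ≤ ∑ (upTo l′) (λ i → g (x + r + i))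
  rest = ∑-split f g 0<r short k (x + r) l′ l′≤k r≤l′ fits

-- One coordinate is cut at a time: in a slab of thickness `l` the claim for the remaining
-- coordinates is applied to the functions already summed over that thickness.
∑-cube-split : ∀ d {r n} → 0 < r → r ≤ n → (f g : Vec ℕ d → ℕ) →
  (∀ y (ls : Vec ℕ d) → All (r ≤_) ls → All (_≤ 2 * r) ls → Pointwise _≤_ (y ⊕ ls) (replicate d n) →
    ∑ (box ls) (λ u → f (y ⊕ u)) ≤ ∑ (box ls) (λ u → g (y ⊕ u))) →
  ∑ (cube d n) f ≤ ∑ (cube d n) g
∑-cube-split zero    0<r r≤n f g hyp = hyp [] [] [] [] []
∑-cube-split (suc d) {r} {n} 0<r r≤n f g hyp =
  subst₂ _≤_ (sym (∑-box-∷ n (replicate d n) f)) (sym (∑-box-∷ n (replicate d n) g))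
    (∑-split (λ i → ∑ (cube d n) (λ u → f (i ∷ u))) (λ i → ∑ (cube d n) (λ u → g (i ∷ u))) 0<r slab n 0 n ≤-refl r≤n ≤-refl)
  where
  open ≤-Reasoning
  regroup : ∀ (h : Vec ℕ (suc d) → ℕ) x l y (ls : Vec ℕ d) →
    ∑ (box ls) (λ u → ∑ (upTo l) (λ i → h ((x + i) ∷ (y ⊕ u)))) ≡ ∑ (box (l ∷ ls)) (λ u → h ((x ∷ y) ⊕ u))
  regroup h x l y ls = trans (∑-swap (box ls) (upTo l) _) (sym (∑-box-∷ l ls _))
  slab : ∀ x l → r ≤ l → l ≤ 2 * r → x + l ≤ n →
    ∑ (upTo l) (λ i → ∑ (cube d n) (λ u → f ((x + i) ∷ u))) ≤ ∑ (upTo l) (λ i → ∑ (cube d n) (λ u → g ((x + i) ∷ u)))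
  slab x l r≤l l≤2r x+l≤n = begin
    ∑ (upTo l) (λ i → ∑ (cube d n) (λ u → f ((x + i) ∷ u)))   ≡⟨ ∑-swap (upTo l) (cube d n) _ ⟩
    ∑ (cube d n) (λ u → ∑ (upTo l) (λ i → f ((x + i) ∷ u)))   ≤⟨ ∑-cube-split d 0<r r≤n _ _ (λ y ls ps qs fit →
        subst₂ _≤_ (sym (regroup f x l y ls)) (sym (regroup g x l y ls)) (hyp (x ∷ y) (l ∷ ls) (r≤l ∷ ps) (l≤2r ∷ qs) (x+l≤n ∷ fit))) ⟩
    ∑ (cube d n) (λ u → ∑ (upTo l) (λ i → g ((x + i) ∷ u)))   ≡⟨ ∑-swap (upTo l) (cube d n) _ ⟨
    ∑ (upTo l) (λ i → ∑ (cube d n) (λ u → g ((x + i) ∷ u)))   ∎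

-- Colourings of boxes

module Colouring {C : Set} (_≟_ : DecidableEquality C) where

  -- The discrete metric; by its triangle inequality a path between two colours pays at least one
  -- crossing.
  ρ : C → C → ℕ
  ρ a b = 𝟙 (¬? (a ≟ b))

  ρ-self : ∀ a → ρ a a ≡ 0
  ρ-self a with a ≟ a
  ... | yes _  = refl
  ... | no a≢a = contradiction refl a≢a

  ρ-sym : ∀ a b → ρ a b ≡ ρ b a
  ρ-sym a b with a ≟ b | b ≟ a
  ... | yes _   | yes _   = refl
  ... | no _    | no _    = refl
  ... | yes a≡b | no b≢a  = contradiction (sym a≡b) b≢a
  ... | no a≢b  | yes b≡a = contradiction (sym b≡a) a≢b

  ρ-triangle : ∀ a b c → ρ a c ≤ ρ a b + ρ b c
  ρ-triangle a b c with a ≟ c | a ≟ b | b ≟ c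
  ... | yes _   | _        | _        = z≤n
  ... | no _    | no _     | _        = s≤s z≤n
  ... | no _    | yes _    | no _     = ≤-refl
  ... | no a≢c  | yes refl | yes refl = contradiction refl a≢c

  -- An arc is counted at its tail, even when its head lies just outside the box at hand. Counts
  -- over disjoint boxes therefore add up.
  crossings : (Vec ℕ d → C) → Vec ℕ d → ℕ
  crossings χ []      = 0
  crossings χ (i ∷ u) = ρ (χ (i ∷ u)) (χ (suc i ∷ u)) + crossings (χ ∘ (i ∷_)) u

  crossings-⊕ : ∀ (χ : Vec ℕ d → C) y u → crossings (χ ∘ (y ⊕_)) u ≡ crossings χ (y ⊕ u)
  crossings-⊕ χ []      []      = refl
  crossings-⊕ χ (x ∷ y) (i ∷ u) = cong₂ _+_
    (cong (λ z → ρ (χ ((x + i) ∷ (y ⊕ u))) (χ (z ∷ (y ⊕ u)))) (+-suc x i))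
    (crossings-⊕ (χ ∘ ((x + i) ∷_)) y u)

  crossings-≤ : ∀ (χ : Vec ℕ d → C) u {b} → (∀ j → ρ (χ u) (χ (updateAt u j suc)) ≤ b) → crossings χ u ≤ d * b
  crossings-≤ χ []      le = z≤n
  crossings-≤ χ (i ∷ u) le = +-mono-≤ (le Fin.zero) (crossings-≤ (χ ∘ (i ∷_)) u (le ∘ Fin.suc))

  ρ-path : ∀ k (χ : ℕ → C) → ρ (χ 0) (χ k) ≤ ∑ (upTo k) (λ i → ρ (χ i) (χ (suc i)))
  ρ-path zero    χ = ≤-reflexive (ρ-self (χ 0))
  ρ-path (suc k) χ = begin
    ρ (χ 0) (χ (suc k))                                                        ≤⟨ ρ-triangle (χ 0) (χ 1) (χ (suc k)) ⟩
    ρ (χ 0) (χ 1) + ρ (χ 1) (χ (suc k))                                        ≤⟨ +-monoʳ-≤ _ (ρ-path k (χ ∘ suc)) ⟩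
    ρ (χ 0) (χ 1) + ∑ (upTo k) (λ i → ρ (χ (suc i)) (χ (suc (suc i))))         ≡⟨ ∑-upTo-suc k _ ⟨
    ∑ (upTo (suc k)) (λ i → ρ (χ i) (χ (suc i)))                               ∎
    where open ≤-Reasoning

  ρ-line-≤ : ∀ (χ : ℕ → C) {l i j} → i ≤ j → j < l → ρ (χ i) (χ j) ≤ ∑ (upTo l) (λ k → ρ (χ k) (χ (suc k)))
  ρ-line-≤ χ {l} {i} {j} i≤j j<l = begin
    ρ (χ i) (χ j)                                                       ≡⟨ cong₂ (λ a b → ρ (χ a) (χ b)) (sym (+-identityʳ i)) (sym (m+[n∸m]≡n i≤j)) ⟩
    ρ (χ (i + 0)) (χ (i + (j ∸ i)))                                     ≤⟨ ρ-path (j ∸ i) (χ ∘ (i +_)) ⟩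
    ∑ (upTo (j ∸ i)) (λ k → ρ (χ (i + k)) (χ (i + suc k)))              ≡⟨ ∑-cong (upTo (j ∸ i)) (λ k → cong (λ z → ρ (χ (i + k)) (χ z)) (+-suc i k)) ⟩
    ∑ (upTo (j ∸ i)) (λ k → ρ (χ (i + k)) (χ (suc (i + k))))            ≤⟨ ∑-upTo-window (j ∸ i) _ (≤-trans (≤-reflexive (m+[n∸m]≡n i≤j)) (<⇒≤ j<l)) ⟩
    ∑ (upTo l) (λ k → ρ (χ k) (χ (suc k)))                              ∎
    where open ≤-Reasoning

  ρ-line : ∀ (χ : ℕ → C) {l i j} → i < l → j < l → ρ (χ i) (χ j) ≤ ∑ (upTo l) (λ k → ρ (χ k) (χ (suc k)))
  ρ-line χ {l} {i} {j} i<l j<l with ≤-total i j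
  ... | inj₁ i≤j = ρ-line-≤ χ i≤j j<l
  ... | inj₂ j≤i = ≤-trans (≤-reflexive (ρ-sym (χ i) (χ j))) (ρ-line-≤ χ j≤i i<l)

  disagreements : Vec ℕ d → (Vec ℕ d → C) → ℕ
  disagreements ls χ = ∑ (box ls) (λ u → ∑ (box ls) (λ v → ρ (χ u) (χ v)))

  -- A Poincaré inequality. To pass from (i , u) to (j , v), first move u to v inside
  -- the slice i, then move i to j along a line; the latter costs at most all the crossings on that line.
  poincaré : ∀ {R} (ls : Vec ℕ d) (χ : Vec ℕ d → C) → All (_≤ R) ls →
    disagreements ls χ ≤ R * (length (box ls) * ∑ (box ls) (crossings χ))
  poincaré         []       χ []       = ≤-trans (≤-reflexive (trans (+-identityʳ _) (trans (+-identityʳ _) (ρ-self (χ []))))) z≤n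
  poincaré {R = R} (l ∷ ls) χ (p ∷ ps) = begin
    disagreements (l ∷ ls) χ
      ≡⟨ ∑-box-∷ l ls _ ⟩
    ∑ (upTo l) (λ i → ∑ (box ls) (λ u → ∑ (box (l ∷ ls)) (λ v → ρ (χ (i ∷ u)) (χ v))))
      ≤⟨ ∑-mono (upTo l) (λ {i} i∈ → ∑-mono (box ls) (λ {u} _ → step i u (∈-upTo⁻ i∈))) ⟩
    ∑ (upTo l) (λ i → ∑ (box ls) (λ u → l * ∑ (box ls) (λ v → ρ (χ (i ∷ u)) (χ (i ∷ v))) + l * along))
      ≡⟨ ∑-cong (upTo l) (λ i → trans (∑-+ (box ls) _ _) (cong₂ _+_ (∑-*ˡ (box ls) l _) (∑-const (box ls) _))) ⟩
    ∑ (upTo l) (λ i → l * disagreements ls (χ ∘ (i ∷_)) + vol * (l * along))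
      ≡⟨ trans (∑-+ (upTo l) _ _) (cong₂ _+_ (∑-*ˡ (upTo l) l _) (∑-upTo-const l _)) ⟩
    l * ∑ (upTo l) (λ i → disagreements ls (χ ∘ (i ∷_))) + l * (vol * (l * along))
      ≤⟨ +-mono-≤ (*-monoʳ-≤ l slices) (*-monoʳ-≤ l (*-monoʳ-≤ vol (*-monoˡ-≤ along p))) ⟩
    l * (R * (vol * within)) + l * (vol * (R * along))
      ≡⟨ collect l R vol within along ⟩
    R * ((l * vol) * (along + within))
      ≡⟨ cong₂ (λ a b → R * (a * b)) (sym (length-box-∷ l ls)) (sym total) ⟩
    R * (length (box (l ∷ ls)) * ∑ (box (l ∷ ls)) (crossings χ)) ∎
    where
    open ≤-Reasoning
    vol = length (box ls)
    jump : ℕ → Vec ℕ _ → ℕ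
    jump k v = ρ (χ (k ∷ v)) (χ (suc k ∷ v))
    along = ∑ (box ls) (λ v → ∑ (upTo l) (λ k → jump k v))
    within = ∑ (upTo l) (λ i → ∑ (box ls) (crossings (χ ∘ (i ∷_))))
    collect : ∀ l R v w a → l * (R * (v * w)) + l * (v * (R * a)) ≡ R * ((l * v) * (a + w))
    collect = solve-∀
    step : ∀ i u → i < l → ∑ (box (l ∷ ls)) (λ v → ρ (χ (i ∷ u)) (χ v)) ≤
      l * ∑ (box ls) (λ v → ρ (χ (i ∷ u)) (χ (i ∷ v))) + l * along
    step i u i<l = begin
      ∑ (box (l ∷ ls)) (λ v → ρ (χ (i ∷ u)) (χ v))
        ≡⟨ ∑-box-∷ l ls _ ⟩
      ∑ (upTo l) (λ j → ∑ (box ls) (λ v → ρ (χ (i ∷ u)) (χ (j ∷ v))))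
        ≤⟨ ∑-mono (upTo l) (λ {j} j∈ → ∑-mono (box ls) (λ {v} _ →
             ≤-trans (ρ-triangle _ (χ (i ∷ v)) _) (+-monoʳ-≤ _ (ρ-line (χ ∘ (_∷ v)) i<l (∈-upTo⁻ j∈))))) ⟩
      ∑ (upTo l) (λ _ → ∑ (box ls) (λ v → ρ (χ (i ∷ u)) (χ (i ∷ v)) + ∑ (upTo l) (λ k → jump k v)))
        ≡⟨ trans (∑-upTo-const l _) (cong (l *_) (∑-+ (box ls) _ _)) ⟩
      l * (∑ (box ls) (λ v → ρ (χ (i ∷ u)) (χ (i ∷ v))) + along)
        ≡⟨ *-distribˡ-+ l _ along ⟩
      l * ∑ (box ls) (λ v → ρ (χ (i ∷ u)) (χ (i ∷ v))) + l * along ∎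
    slices : ∑ (upTo l) (λ i → disagreements ls (χ ∘ (i ∷_))) ≤ R * (vol * within)
    slices = begin
      ∑ (upTo l) (λ i → disagreements ls (χ ∘ (i ∷_)))
        ≤⟨ ∑-mono (upTo l) (λ {i} _ → poincaré ls (χ ∘ (i ∷_)) ps) ⟩
      ∑ (upTo l) (λ i → R * (vol * ∑ (box ls) (crossings (χ ∘ (i ∷_)))))
        ≡⟨ trans (∑-*ˡ (upTo l) R _) (cong (R *_) (∑-*ˡ (upTo l) vol _)) ⟩
      R * (vol * within) ∎
    total : ∑ (box (l ∷ ls)) (crossings χ) ≡ along + within
    total = begin-equality
      ∑ (box (l ∷ ls)) (crossings χ)
        ≡⟨ ∑-box-∷ l ls _ ⟩
      ∑ (upTo l) (λ i → ∑ (box ls) (λ u → jump i u + crossings (χ ∘ (i ∷_)) u))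
        ≡⟨ ∑-cong (upTo l) (λ i → ∑-+ (box ls) _ _) ⟩
      ∑ (upTo l) (λ i → ∑ (box ls) (jump i) + ∑ (box ls) (crossings (χ ∘ (i ∷_))))
        ≡⟨ ∑-+ (upTo l) _ _ ⟩
      ∑ (upTo l) (λ i → ∑ (box ls) (jump i)) + within
        ≡⟨ cong (_+ within) (∑-swap (upTo l) (box ls) jump) ⟩
      along + within ∎

  frequency : (Vec ℕ d → C) → C → List (Vec ℕ d) → ℕ
  frequency χ c us = ∑ us (λ u → 𝟙 (χ u ≟ c))

  frequency-complement : ∀ (χ : Vec ℕ d → C) c us → frequency χ c us + ∑ us (λ u → ρ c (χ u)) ≡ length us
  frequency-complement χ c us = trans (sym (∑-+ us _ _)) (trans (∑-cong us pointwise) (∑-one us))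
    where
    pointwise : ∀ u → 𝟙 (χ u ≟ c) + ρ c (χ u) ≡ 1
    pointwise u rewrite ρ-sym c (χ u) with χ u ≟ c
    ... | yes _ = refl
    ... | no _  = refl

  -- Each node disagrees with at least half of the box, so at least half of all pairs disagree, and
  -- `poincaré` converts pairs into crossings.
  no-majority : ∀ {R} (ls : Vec ℕ d) (χ : Vec ℕ d → C) → All (_≤ R) ls →
    (∀ c → 2 * frequency χ c (box ls) ≤ length (box ls)) →
    length (box ls) * length (box ls) ≤ length (box ls) * (2 * R * ∑ (box ls) (crossings χ))
  no-majority {R = R} ls χ ps minor = begin
    vol * vol                                                              ≡⟨ ∑-const (box ls) vol ⟨
    ∑ (box ls) (const vol)                                                 ≤⟨ ∑-mono (box ls) (λ {u} _ → half (χ u)) ⟩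
    ∑ (box ls) (λ u → 2 * ∑ (box ls) (λ v → ρ (χ u) (χ v)))                ≡⟨ ∑-*ˡ (box ls) 2 _ ⟩
    2 * disagreements ls χ                                                 ≤⟨ *-monoʳ-≤ 2 (poincaré ls χ ps) ⟩
    2 * (R * (vol * ∑ (box ls) (crossings χ)))                             ≡⟨ assoc R vol (∑ (box ls) (crossings χ)) ⟩
    vol * (2 * R * ∑ (box ls) (crossings χ))                               ∎
    where
    open ≤-Reasoning
    vol = length (box ls)
    assoc : ∀ R v c → 2 * (R * (v * c)) ≡ v * (2 * R * c)
    assoc = solve-∀
    half : ∀ c → vol ≤ 2 * ∑ (box ls) (λ v → ρ c (χ v))
    half c = +-cancelˡ-≤ vol _ _ (begin
      vol + vol                                            ≡⟨ cong (vol +_) (+-identityʳ vol) ⟨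
      2 * vol                                              ≡⟨ cong (2 *_) (frequency-complement χ c (box ls)) ⟨
      2 * (frequency χ c (box ls) + s)                     ≡⟨ *-distribˡ-+ 2 (frequency χ c (box ls)) s ⟩
      2 * frequency χ c (box ls) + 2 * s                   ≤⟨ +-monoˡ-≤ (2 * s) (minor c) ⟩
      vol + 2 * s                                          ∎)
      where s = ∑ (box ls) (λ v → ρ c (χ v))

  -- The left side counts the disagreeing pairs whose first node has colour `c`.
  colour-boundary : ∀ {R} (ls : Vec ℕ d) (χ : Vec ℕ d → C) c → All (_≤ R) ls →
    frequency χ c (box ls) * (length (box ls) ∸ frequency χ c (box ls)) ≤ R * (length (box ls) * ∑ (box ls) (crossings χ))
  colour-boundary {R = R} ls χ c ps = begin
    a * (length (box ls) ∸ a)                                           ≡⟨ cong (λ z → a * (z ∸ a)) (frequency-complement χ c (box ls)) ⟨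
    a * (a + rest ∸ a)                                                  ≡⟨ cong (a *_) (m+n∸m≡n a rest) ⟩
    a * rest                                                            ≡⟨ ∑-*ʳ (box ls) rest _ ⟨
    ∑ (box ls) (λ u → 𝟙 (χ u ≟ c) * rest)                               ≤⟨ ∑-mono (box ls) (λ {u} _ → pointwise u) ⟩
    disagreements ls χ                                                  ≤⟨ poincaré ls χ ps ⟩
    R * (length (box ls) * ∑ (box ls) (crossings χ))                    ∎
    where
    open ≤-Reasoning
    a = frequency χ c (box ls)
    rest = ∑ (box ls) (λ v → ρ c (χ v))
    pointwise : ∀ u → 𝟙 (χ u ≟ c) * rest ≤ ∑ (box ls) (λ v → ρ (χ u) (χ v))
    pointwise u with χ u ≟ c
    ... | yes refl = ≤-reflexive (+-identityʳ rest)
    ... | no _     = z≤n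

  -- For a minority the complement is at least half of the volume, so the volume cancels in
  -- `colour-boundary`; the empty box is treated apart for the sake of this cancellation.
  minority-boundary : ∀ {R} (ls : Vec ℕ d) (χ : Vec ℕ d → C) c → All (_≤ R) ls →
    2 * frequency χ c (box ls) ≤ length (box ls) →
    frequency χ c (box ls) ≤ 2 * R * ∑ (box ls) (crossings χ)
  minority-boundary {R = R} ls χ c ps 2a≤vol with length (box ls) in eq
  ... | zero  = ≤-trans (m≤m+n a (a + 0)) (≤-trans 2a≤vol z≤n)
    where a = frequency χ c (box ls)
  ... | vol@(suc _) = *-cancelʳ-≤ a _ vol (begin
    a * vol                                  ≤⟨ *-monoʳ-≤ a vol≤ ⟩
    a * (2 * (vol ∸ a))                      ≡⟨ shuffle a (vol ∸ a) ⟩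
    2 * (a * (vol ∸ a))                      ≤⟨ *-monoʳ-≤ 2 (subst (λ v → a * (v ∸ a) ≤ R * (v * E)) eq (colour-boundary ls χ c ps)) ⟩
    2 * (R * (vol * E))                      ≡⟨ assoc R vol E ⟩
    2 * R * E * vol                          ∎)
    where
    open ≤-Reasoning
    a = frequency χ c (box ls)
    E = ∑ (box ls) (crossings χ)
    shuffle : ∀ a b → a * (2 * b) ≡ 2 * (a * b)
    shuffle = solve-∀
    assoc : ∀ R v e → 2 * (R * (v * e)) ≡ 2 * R * e * v
    assoc = solve-∀
    vol≤ : vol ≤ 2 * (vol ∸ a)
    vol≤ = begin
      vol                 ≡⟨ m+n∸n≡m vol vol ⟨
      vol + vol ∸ vol     ≤⟨ ∸-monoʳ-≤ (vol + vol) 2a≤vol ⟩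
      vol + vol ∸ 2 * a   ≡⟨ cong (λ z → vol + z ∸ 2 * a) (+-identityʳ vol) ⟨
      2 * vol ∸ 2 * a     ≡⟨ *-distribˡ-∸ 2 vol a ⟨
      2 * (vol ∸ a)       ∎

-- Crossing arcs and messages

maxOver-upper : ∀ (f : Fin p → ℕ) q → f q ≤ maxOver p f
maxOver-upper f q = go (∈-allFin q)
  where
  go : ∀ {xs} → q ∈ xs → f q ≤ foldr _⊔_ 0 (map f xs)
  go (here refl) = m≤m⊔n _ _
  go (there q∈)  = ≤-trans (go q∈) (m≤n⊔m _ _)

maxOver-attained : ∀ (f : Fin (suc p) → ℕ) → ∃[ q ] f q ≡ maxOver (suc p) f
maxOver-attained f = go Fin.zero (tabulate Fin.suc)
  where
  go : ∀ x xs → ∃[ q ] f q ≡ foldr _⊔_ 0 (map f (x ∷ xs))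
  go x []       = x , sym (⊔-identityʳ (f x))
  go x (y ∷ ys) with go y ys
  ... | q , eq with ⊔-sel (f x) (foldr _⊔_ 0 (map f (y ∷ ys)))
  ... | inj₁ max≡ = x , sym max≡
  ... | inj₂ max≡ = q , trans eq (sym max≡)

-- Values beyond the grid are projected to its boundary, so that no crossing leads out of the grid.
clamp : ∀ k → ℕ → Fin (suc k)
clamp k       zero    = Fin.zero
clamp zero    (suc i) = Fin.zero
clamp (suc k) (suc i) = Fin.suc (clamp k i)

toℕ-clamp : ∀ {k i} → i ≤ k → toℕ (clamp k i) ≡ i
toℕ-clamp z≤n       = refl
toℕ-clamp (s≤s i≤k) = cong suc (toℕ-clamp i≤k)

clamp-toℕ : ∀ {k} (i : Fin (suc k)) → clamp k (toℕ i) ≡ i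
clamp-toℕ         Fin.zero    = refl
clamp-toℕ {suc k} (Fin.suc i) = cong Fin.suc (clamp-toℕ i)

clamp-suc : ∀ k i → clamp k (suc i) ≡ clamp k i ⊎ toℕ (clamp k (suc i)) ≡ suc (toℕ (clamp k i))
clamp-suc zero    zero    = inj₁ refl
clamp-suc zero    (suc i) = inj₁ refl
clamp-suc (suc k) zero    = inj₂ refl
clamp-suc (suc k) (suc i) with clamp-suc k i
... | inj₁ eq = inj₁ (cong Fin.suc eq)
... | inj₂ eq = inj₂ (cong suc eq)

cell : ∀ {k} → Vec ℕ d → Node (suc k) d
cell = Vec.map (clamp _)

cell-suc : ∀ {k} (u : Vec ℕ d) j → cell {k = k} (updateAt u j suc) ≡ cell u ⊎ Arc (cell {k = k} u) (cell (updateAt u j suc))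
cell-suc {k = k} (i ∷ u) Fin.zero with clamp-suc k i
... | inj₁ eq = inj₁ (cong (_∷ cell u) eq)
... | inj₂ eq = inj₂ (Fin.zero , eq , λ where
  Fin.zero    0≢0 → contradiction refl 0≢0
  (Fin.suc j) _   → refl)
cell-suc {k = k} (i ∷ u) (Fin.suc j) with cell-suc {k = k} u j
... | inj₁ eq = inj₁ (cong (clamp k i ∷_) eq)
... | inj₂ (a , eq , same) = inj₂ (Fin.suc a , eq , λ where
  Fin.zero     _   → refl
  (Fin.suc j′) j≢a → same j′ (j≢a ∘ cong Fin.suc))

toℕ-cell : ∀ {k} {u : Vec ℕ d} → Pointwise _<_ u (replicate d (suc k)) → Vec.map toℕ (cell {k = k} u) ≡ u
toℕ-cell {u = []}    []       = refl
toℕ-cell {u = i ∷ u} (p ∷ ps) = cong₂ _∷_ (toℕ-clamp (s≤s⁻¹ p)) (toℕ-cell ps)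

∑-allNodes : ∀ d {k} (f : Node (suc k) d → ℕ) → ∑ (allNodes (suc k) d) f ≡ ∑ (cube d (suc k)) (f ∘ cell)
∑-allNodes zero        f = refl
∑-allNodes (suc d) {k} f = begin
  ∑ (allNodes (suc k) (suc d)) f
    ≡⟨ ∑-concatMap (λ i → map (i ∷_) (allNodes (suc k) d)) (allFin (suc k)) f ⟩
  ∑ (allFin (suc k)) (λ i → ∑ (map (i ∷_) (allNodes (suc k) d)) f)
    ≡⟨ ∑-cong (allFin (suc k)) (λ i → trans (∑-map (i ∷_) (allNodes (suc k) d) f) (∑-allNodes d (f ∘ (i ∷_)))) ⟩
  ∑ (allFin (suc k)) (λ i → ∑ (cube d (suc k)) (λ u → f (i ∷ cell u)))
    ≡⟨ ∑-cong (allFin (suc k)) (λ i → cong (λ z → ∑ (cube d (suc k)) (λ u → f (z ∷ cell u))) (sym (clamp-toℕ i))) ⟩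
  ∑ (allFin (suc k)) (λ i → ∑ (cube d (suc k)) (λ u → f (clamp k (toℕ i) ∷ cell u)))
    ≡⟨ ∑-allFin (suc k) (λ i → ∑ (cube d (suc k)) (λ u → f (clamp k i ∷ cell u))) ⟩
  ∑ (upTo (suc k)) (λ i → ∑ (cube d (suc k)) (λ u → f (clamp k i ∷ cell u)))
    ≡⟨ ∑-box-∷ (suc k) (replicate d (suc k)) _ ⟨
  ∑ (cube (suc d) (suc k)) (f ∘ cell) ∎
  where open ≡-Reasoning

monotone-from-steps : ∀ (f : Vec ℕ d → ℕ) → (∀ u j → f u ≤ f (updateAt u j suc)) →
  ∀ {u v} → Pointwise _≤_ u v → f u ≤ f v
monotone-from-steps f up []                       = ≤-refl
monotone-from-steps f up (_∷_ {x = i} {j} {xs = u} {v} i≤j u≤v) =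
  ≤-trans (climb (≤⇒≤′ i≤j)) (monotone-from-steps (f ∘ (j ∷_)) (λ w → up (j ∷ w) ∘ Fin.suc) u≤v)
  where
  climb : ∀ {k} → i ≤′ k → f (i ∷ u) ≤ f (k ∷ u)
  climb (≤′-reflexive refl) = ≤-refl
  climb (≤′-step i≤k)      = ≤-trans (climb i≤k) (up (_ ∷ u) Fin.zero)

⊕-upper : ∀ (y u : Vec ℕ d) → Pointwise _≤_ y (y ⊕ u)
⊕-upper []      []      = []
⊕-upper (x ∷ y) (i ∷ u) = m≤m+n x i ∷ ⊕-upper y u

⊕-mono-< : ∀ (y : Vec ℕ d) {u ls ms : Vec ℕ d} → Pointwise _<_ u ls → Pointwise _≤_ (y ⊕ ls) ms → Pointwise _<_ (y ⊕ u) ms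
⊕-mono-< []      []       []       = []
⊕-mono-< (x ∷ y) (p ∷ ps) (q ∷ qs) = <-≤-trans (+-monoʳ-< x p) q ∷ ⊕-mono-< y ps qs

<⇒updateAt-≤ : ∀ {u v : Vec ℕ d} → Pointwise _<_ u v → ∀ j → Pointwise _≤_ (updateAt u j suc) v
<⇒updateAt-≤ (p ∷ ps) Fin.zero    = p ∷ Pointwise.map <⇒≤ ps
<⇒updateAt-≤ (p ∷ ps) (Fin.suc j) = <⇒≤ p ∷ <⇒updateAt-≤ ps j

∑-𝟙-injective : ∀ l (f : ℕ → ℕ) → (∀ {i j} → f i ≡ f j → i ≡ j) → ∀ w → ∑ (upTo l) (λ i → 𝟙 (f i ℕₚ.≟ w)) ≤ 1
∑-𝟙-injective zero    f inj w = z≤n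
∑-𝟙-injective (suc l) f inj w = ≤-trans (≤-reflexive (∑-upTo-suc l (λ i → 𝟙 (f i ℕₚ.≟ w)))) (by-cases (f 0 ℕₚ.≟ w))
  where
  open ≤-Reasoning
  tail = ∑ (upTo l) (λ i → 𝟙 (f (suc i) ℕₚ.≟ w))
  by-cases : Dec (f 0 ≡ w) → 𝟙 (f 0 ℕₚ.≟ w) + tail ≤ 1
  by-cases (no f0≢w)  = ≤-trans (≤-reflexive (cong (_+ tail) (𝟙-no (f 0 ℕₚ.≟ w) f0≢w))) (∑-𝟙-injective l (f ∘ suc) (suc-injective ∘ inj) w)
  by-cases (yes refl) = begin
    𝟙 (f 0 ℕₚ.≟ f 0) + tail      ≡⟨ cong (𝟙 (f 0 ℕₚ.≟ f 0) +_) (∑-cong (upTo l) (λ i → 𝟙-no (f (suc i) ℕₚ.≟ f 0) (λ eq → 1+n≢0 (inj eq)))) ⟩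
    𝟙 (f 0 ℕₚ.≟ f 0) + ∑ (upTo l) (const 0) ≡⟨ cong (𝟙 (f 0 ℕₚ.≟ f 0) +_) (trans (∑-upTo-const l 0) (*-zeroʳ l)) ⟩
    𝟙 (f 0 ℕₚ.≟ f 0) + 0         ≡⟨ +-identityʳ _ ⟩
    𝟙 (f 0 ℕₚ.≟ f 0)             ≤⟨ 𝟙≤1 (f 0 ℕₚ.≟ f 0) ⟩
    1                            ∎

-- Translation is injective. This keeps a message from being charged to two different nodes.
∑-box-𝟙 : ∀ (ls y w : Vec ℕ d) → ∑ (box ls) (λ u → 𝟙 ((y ⊕ u) ≟ᵥ w)) ≤ 1
∑-box-𝟙 []       y       w       = ≤-trans (≤-reflexive (+-identityʳ _)) (𝟙≤1 ((y ⊕ []) ≟ᵥ w))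
∑-box-𝟙 (l ∷ ls) (x ∷ y) (z ∷ w) = begin
  ∑ (box (l ∷ ls)) (λ u → 𝟙 (((x ∷ y) ⊕ u) ≟ᵥ (z ∷ w)))                             ≡⟨ ∑-box-∷ l ls _ ⟩
  ∑ (upTo l) (λ i → ∑ (box ls) (λ u → 𝟙 (((x + i) ∷ (y ⊕ u)) ≟ᵥ (z ∷ w))))           ≤⟨ ∑-mono (upTo l) (λ {i} _ → ∑-mono (box ls) (λ {u} _ → both (x + i) (y ⊕ u))) ⟩
  ∑ (upTo l) (λ i → ∑ (box ls) (λ u → 𝟙 (x + i ℕₚ.≟ z) * 𝟙 ((y ⊕ u) ≟ᵥ w)))          ≡⟨ ∑-cong (upTo l) (λ i → ∑-*ˡ (box ls) (𝟙 (x + i ℕₚ.≟ z)) _) ⟩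
  ∑ (upTo l) (λ i → 𝟙 (x + i ℕₚ.≟ z) * ∑ (box ls) (λ u → 𝟙 ((y ⊕ u) ≟ᵥ w)))          ≤⟨ ∑-mono (upTo l) (λ {i} _ → *-monoʳ-≤ (𝟙 (x + i ℕₚ.≟ z)) (∑-box-𝟙 ls y w)) ⟩
  ∑ (upTo l) (λ i → 𝟙 (x + i ℕₚ.≟ z) * 1)                                           ≡⟨ ∑-cong (upTo l) (λ i → *-identityʳ _) ⟩
  ∑ (upTo l) (λ i → 𝟙 (x + i ℕₚ.≟ z))                                               ≤⟨ ∑-𝟙-injective l (x +_) (λ {i} {j} → +-cancelˡ-≡ x i j) z ⟩
  1                                                                                 ∎
  where
  open ≤-Reasoning
  both : ∀ a b → 𝟙 ((a ∷ b) ≟ᵥ (z ∷ w)) ≤ 𝟙 (a ℕₚ.≟ z) * 𝟙 (b ≟ᵥ w)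
  both a b = by-cases (a ℕₚ.≟ z) (b ≟ᵥ w)
    where
    by-cases : ∀ (P? : Dec (a ≡ z)) (Q? : Dec (b ≡ w)) → 𝟙 ((a ∷ b) ≟ᵥ (z ∷ w)) ≤ 𝟙 P? * 𝟙 Q?
    by-cases (yes _) (yes _)  = 𝟙≤1 ((a ∷ b) ≟ᵥ (z ∷ w))
    by-cases (yes _) (no b≢w) = ≤-reflexive (𝟙-no ((a ∷ b) ≟ᵥ (z ∷ w)) (λ { refl → b≢w refl }))
    by-cases (no a≢z) _       = ≤-reflexive (𝟙-no ((a ∷ b) ≟ᵥ (z ∷ w)) (λ { refl → a≢z refl }))

module Communication {k d p : ℕ} (E : Execution (suc k) d p) where
  open Execution E

  n₁ : ℕ
  n₁ = suc k

  -- A message may relay a received value; its relays are followed back in time.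
  origin : ∀ m → m ∈ msgs → ∃[ m′ ] (m′ ∈ msgs × node m′ ≡ node m × src m′ ≡ proc (node m) × step (node m) ≤ time m′ × time m′ ≤ time m)
  origin m = go m (<-wellFounded (time m))
    where
    go : ∀ m → Acc _<_ (time m) → m ∈ msgs →
      ∃[ m′ ] (m′ ∈ msgs × node m′ ≡ node m × src m′ ≡ proc (node m) × step (node m) ≤ time m′ × time m′ ≤ time m)
    go m (acc rec) m∈ with ListAll.lookup sendOK m∈
    ... | inj₁ (proc≡ , step≤) = m , m∈ , refl , sym proc≡ , step≤ , ≤-refl
    ... | inj₂ (m₁ , m₁∈ , _ , node≡ , earlier) with go m₁ (rec earlier) m₁∈
    ... | m′ , m′∈ , node′ , src′ , after , before =
      m′ , m′∈ , trans node′ node≡ , trans src′ (cong proc node≡) , subst (λ v → step v ≤ time m′) node≡ after ,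
      ≤-trans before (<⇒≤ earlier)

  -- A message becomes usable only after its own superstep, so the time window is half-open, and
  -- windows that follow each other share no superstep.
  Transfer : Node n₁ d → Node n₁ d → Msg n₁ d p → Set
  Transfer u v m = m ∈ msgs × node m ≡ u × step u ≤ time m × time m < step v

  received : ∀ {u v} → Arc u v → proc u ≢ proc v → ∃[ m ] (Transfer u v m × dst m ≡ proc v)
  received {u} {v} arc u≢v with evalOK u v arc
  ... | inj₁ (same , _) = contradiction same u≢v
  ... | inj₂ (m , m∈ , dst≡ , node≡ , before) with origin m m∈
  ... | m′ , _ , _ , _ , after , m′≤m =
    m , (m∈ , node≡ , ≤-trans (subst (λ w → step w ≤ time m′) node≡ after) m′≤m , before) , dst≡

  -- The message that reaches `proc v` may be a relay from a third processor. The start of its chain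
  -- of relays is sent by `proc u` itself, as a bound on the traffic of one processor requires.
  emitted : ∀ {u v} → Arc u v → proc u ≢ proc v → ∃[ m ] (Transfer u v m × src m ≡ proc u)
  emitted {u} {v} arc u≢v with received arc u≢v
  ... | m , (m∈ , node≡ , _ , before) , _ with origin m m∈
  ... | m′ , m′∈ , node′ , src′ , after , m′≤m =
    m′ , (m′∈ , trans node′ node≡ , subst (λ w → step w ≤ time m′) node≡ after , ≤-<-trans m′≤m before) ,
    trans src′ (cong proc node≡)

  step-arc : ∀ {u v} → Arc u v → step u ≤ step v
  step-arc {u} {v} arc with proc u ≟ proc v
  ... | no u≢v with received arc u≢v
  ...   | _ , (_ , _ , after , before) , _ = ≤-trans after (<⇒≤ before)
  step-arc {u} {v} arc | yes same with evalOK u v arc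
  ... | inj₁ (_ , u≤v) = u≤v
  -- A processor may get its own value back through relays; that chain, too, starts no earlier than
  -- the evaluation of `u`.
  ... | inj₂ (m , m∈ , _ , node≡ , before) with origin m m∈
  ... | m′ , _ , _ , _ , after , m′≤m = ≤-trans (subst (λ w → step w ≤ time m′) node≡ after) (≤-trans m′≤m (<⇒≤ before))

  step-mono : ∀ {u v : Vec ℕ d} → Pointwise _≤_ u v → step (cell u) ≤ step (cell v)
  step-mono = monotone-from-steps (step ∘ cell) up
    where
    up : ∀ u j → step (cell u) ≤ step (cell (updateAt u j suc))
    up u j with cell-suc {k = k} u j
    ... | inj₁ eq  = ≤-reflexive (cong step (sym eq))
    ... | inj₂ arc = step-arc arc

  crossing-arc : ∀ {A : Set} (χ : Node n₁ d → A) u j → χ (cell u) ≢ χ (cell (updateAt u j suc)) → Arc (cell u) (cell (updateAt u j suc))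
  crossing-arc χ u j χ≢ with cell-suc {k = k} u j
  ... | inj₁ eq  = contradiction (cong χ (sym eq)) χ≢
  ... | inj₂ arc = arc

  proc≢ : ∀ {A : Set} (χ : Fin p → A) {u v} → χ (proc u) ≢ χ (proc v) → proc u ≢ proc v
  proc≢ χ χ≢ eq = χ≢ (cong χ eq)

  sent≤h : ∀ q s → sent q s ≤ h s
  sent≤h q s = ≤-trans (m≤m⊔n _ (recv q s)) (maxOver-upper (λ q → sent q s ⊔ recv q s) q)

  recv≤h : ∀ q s → recv q s ≤ h s
  recv≤h q s = ≤-trans (m≤n⊔m (sent q s) _) (maxOver-upper (λ q → sent q s ⊔ recv q s) q)

  messages≤pH : length msgs ≤ p * H
  messages≤pH = begin
    length msgs                                                              ≡⟨ ∑-one msgs ⟨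
    ∑ msgs (const 1)                                                         ≤⟨ ∑-mono msgs counted ⟩
    ∑ msgs (λ m → ∑ (upTo S) (λ s → ∑ (allFin p) (λ q → sends m q s)))       ≡⟨ ∑-swap msgs (upTo S) _ ⟩
    ∑ (upTo S) (λ s → ∑ msgs (λ m → ∑ (allFin p) (λ q → sends m q s)))       ≡⟨ ∑-cong (upTo S) (λ s → ∑-swap msgs (allFin p) _) ⟩
    ∑ (upTo S) (λ s → ∑ (allFin p) (λ q → ∑ msgs (λ m → sends m q s)))       ≡⟨ ∑-cong (upTo S) (λ s → ∑-cong (allFin p) (λ q → sym (length-filter _ msgs))) ⟩
    ∑ (upTo S) (λ s → ∑ (allFin p) (λ q → sent q s))                         ≤⟨ ∑-mono (upTo S) (λ {s} _ → ∑-mono (allFin p) (λ {q} _ → sent≤h q s)) ⟩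
    ∑ (upTo S) (λ s → ∑ (allFin p) (λ _ → h s))                              ≡⟨ ∑-cong (upTo S) (λ s → trans (∑-const (allFin p) (h s)) (cong (_* h s) (length-tabulate {n = p} id))) ⟩
    ∑ (upTo S) (λ s → p * h s)                                               ≡⟨ ∑-*ˡ (upTo S) p h ⟩
    p * H                                                                    ∎
    where
    open ≤-Reasoning
    sends : Msg n₁ d p → Fin p → ℕ → ℕ
    sends m q s = 𝟙 ((src m ≟ q) ×-dec (time m ℕₚ.≟ s))
    counted : ∀ {m} → m ∈ msgs → 1 ≤ ∑ (upTo S) (λ s → ∑ (allFin p) (λ q → sends m q s))
    counted {m} m∈ = begin
      1                                                        ≡⟨ 𝟙-yes ((src m ≟ src m) ×-dec (time m ℕₚ.≟ time m)) (refl , refl) ⟨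
      sends m (src m) (time m)                                 ≤⟨ ∑-member (λ q → sends m q (time m)) (∈-allFin (src m)) ⟩
      ∑ (allFin p) (λ q → sends m q (time m))                  ≤⟨ ∑-member (λ s → ∑ (allFin p) (λ q → sends m q s)) (∈-upTo⁺ (ListAll.lookup msgs<S m∈)) ⟩
      ∑ (upTo S) (λ s → ∑ (allFin p) (λ q → sends m q s))      ∎

  Fits : Vec ℕ d → Vec ℕ d → Set
  Fits y ls = Pointwise _≤_ (y ⊕ ls) (replicate d n₁)

  load-cube : ∀ q → load q ≡ ∑ (cube d n₁) (λ u → 𝟙 (proc (cell u) ≟ q))
  load-cube q = trans (length-filter (λ v → proc v ≟ q) (allNodes n₁ d)) (∑-allNodes d _)

  occupancy≤W : ∀ q {y ls} → Fits y ls → ∑ (box ls) (λ u → 𝟙 (proc (cell (y ⊕ u)) ≟ q)) ≤ W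
  occupancy≤W q {y} {ls} fits = begin
    ∑ (box ls) (λ u → 𝟙 (proc (cell (y ⊕ u)) ≟ q))     ≤⟨ ∑-box-window ls (λ u → 𝟙 (proc (cell u) ≟ q)) fits ⟩
    ∑ (cube d n₁) (λ u → 𝟙 (proc (cell u) ≟ q))        ≡⟨ load-cube q ⟨
    load q                                            ≤⟨ maxOver-upper load q ⟩
    W                                                 ∎
    where open ≤-Reasoning

  module _ {C : Set} (_≟ᶜ_ : DecidableEquality C) (χ : Node n₁ d → C) where
    open Colouring _≟ᶜ_

    -- A message carries one node, and at most `d` arcs leave that node. `χ` and `weight` stay open
    -- for two uses: all processors with all messages, and the share of one processor with its own
    -- messages in a time window.
    crossings≤messages : ∀ {y ls} (weight : Msg n₁ d p → ℕ) → Fits y ls →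
      (∀ {u} → Pointwise _<_ u ls → ∀ j → χ (cell (y ⊕ u)) ≢ χ (cell (updateAt (y ⊕ u) j suc)) →
        ∃[ m ] (m ∈ msgs × node m ≡ cell (y ⊕ u) × 1 ≤ weight m)) →
      ∑ (box ls) (crossings (λ u → χ (cell (y ⊕ u)))) ≤ d * ∑ msgs weight
    crossings≤messages {y} {ls} weight fits message = begin
      ∑ (box ls) (crossings (λ u → χ (cell (y ⊕ u))))
        ≡⟨ ∑-cong (box ls) (crossings-⊕ (χ ∘ cell) y) ⟩
      ∑ (box ls) (λ u → crossings (χ ∘ cell) (y ⊕ u))
        ≤⟨ ∑-mono (box ls) (λ {u} u∈ → crossings-≤ (χ ∘ cell) (y ⊕ u) (witnessed (∈-box⁻ ls u∈))) ⟩
      ∑ (box ls) (λ u → d * ∑ msgs (λ m → at u m * weight m))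
        ≡⟨ trans (∑-*ˡ (box ls) d _) (cong (d *_) (∑-swap (box ls) msgs _)) ⟩
      d * ∑ msgs (λ m → ∑ (box ls) (λ u → at u m * weight m))
        ≡⟨ cong (d *_) (∑-cong msgs (λ m → ∑-*ʳ (box ls) (weight m) _)) ⟩
      d * ∑ msgs (λ m → ∑ (box ls) (λ u → at u m) * weight m)
        ≤⟨ *-monoʳ-≤ d (∑-mono msgs (λ {m} _ → *-monoˡ-≤ (weight m) (∑-box-𝟙 ls y (Vec.map toℕ (node m))))) ⟩
      d * ∑ msgs (λ m → 1 * weight m)
        ≡⟨ cong (d *_) (∑-cong msgs (λ m → *-identityˡ _)) ⟩
      d * ∑ msgs weight ∎
      where
      open ≤-Reasoning
      at : Vec ℕ d → Msg n₁ d p → ℕ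
      at u m = 𝟙 ((y ⊕ u) ≟ᵥ Vec.map toℕ (node m))
      witnessed : ∀ {u} → Pointwise _<_ u ls → ∀ j →
        ρ (χ (cell (y ⊕ u))) (χ (cell (updateAt (y ⊕ u) j suc))) ≤ ∑ msgs (λ m → at u m * weight m)
      witnessed {u} u< j with χ (cell (y ⊕ u)) ≟ᶜ χ (cell (updateAt (y ⊕ u) j suc))
      ... | yes _ = z≤n
      ... | no χ≢ with message u< j χ≢
      ... | m , m∈ , node≡ , 1≤weight = begin
        1                                         ≤⟨ 1≤weight ⟩
        weight m                                  ≡⟨ *-identityˡ (weight m) ⟨
        1 * weight m                              ≡⟨ cong (_* weight m) (𝟙-yes ((y ⊕ u) ≟ᵥ Vec.map toℕ (node m)) at-node) ⟨
        at u m * weight m                         ≤⟨ ∑-member (λ m → at u m * weight m) m∈ ⟩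
        ∑ msgs (λ m → at u m * weight m)          ∎
        where
        at-node : y ⊕ u ≡ Vec.map toℕ (node m)
        at-node = trans (sym (toℕ-cell (⊕-mono-< y u< fits))) (cong (Vec.map toℕ) (sym node≡))

  open Colouring

  total-crossings : ∀ {ls} → Fits (replicate d 0) ls → ∑ (box ls) (crossings _≟_ (λ u → proc (cell (replicate d 0 ⊕ u)))) ≤ d * (p * H)
  total-crossings {ls} fits = ≤-trans (crossings≤messages _≟_ proc (const 1) fits message)
    (*-monoʳ-≤ d (≤-trans (≤-reflexive (∑-one msgs)) messages≤pH))
    where
    message : ∀ {u} → Pointwise _<_ u ls → ∀ j → _ → _
    message {u} _ j χ≢ with received (crossing-arc proc (replicate d 0 ⊕ u) j χ≢) χ≢
    ... | m , (m∈ , node≡ , _) , _ = m , m∈ , node≡ , ≤-refl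

  -- Written with these partial sums of `H`, bounds over consecutive time windows telescope.
  prefix : ℕ → ℕ
  prefix s = ∑ (upTo s) h

  prefix-mono : ∀ {a b} → a ≤ b → prefix a ≤ prefix b
  prefix-mono {a} {b} a≤b = ∑-upTo-window {0} a h a≤b

  -- Merging all processors but `q` into one colour leaves just the crossing arcs whose values `q`
  -- itself must send or receive.
  owns : Fin p → Node n₁ d → Bool
  owns q v = does (proc v ≟ q)

  -- The two endpoints of a crossing arc disagree on q, so its tail is sent or received by q
  -- between the evaluation of the first and of the last node of the box.
  window-crossings : ∀ q {y ls} → Fits y ls →
    ∑ (box ls) (crossings Boolₚ._≟_ (λ u → owns q (cell (y ⊕ u)))) + 2 * d * prefix (step (cell y)) ≤
    2 * d * prefix (step (cell (y ⊕ ls)))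
  window-crossings q {y} {ls} fits = ≤-trans (+-monoˡ-≤ (2 * d * prefix a) inside) (≤-reflexive (begin-equality
    d * (2 * ∑ (upTo l) (λ s → h (a + s))) + 2 * d * prefix a      ≡⟨ gather d (∑ (upTo l) (λ s → h (a + s))) (prefix a) ⟩
    2 * d * (prefix a + ∑ (upTo l) (λ s → h (a + s)))              ≡⟨ cong (2 * d *_) (∑-upTo-+ a l h) ⟨
    2 * d * prefix (a + l)                                         ≡⟨ cong (λ s → 2 * d * prefix s) (m+[n∸m]≡n (step-mono (⊕-upper y ls))) ⟩
    2 * d * prefix b                                               ∎))
    where
    open ≤-Reasoning
    a = step (cell y)
    -- The corner `y ⊕ ls` lies one step beyond the box, so heads of arcs leaving the box are
    -- evaluated by superstep `b` as well; on a diagonal it is also the first corner of the next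
    -- cube. At the edge of the grid `cell` clamps it.
    b = step (cell (y ⊕ ls))
    l = b ∸ a
    gather : ∀ d x y → d * (2 * x) + 2 * d * y ≡ 2 * d * (y + x)
    gather = solve-∀
    sends receives : Msg n₁ d p → ℕ → ℕ
    sends    m s = 𝟙 ((src m ≟ q) ×-dec (time m ℕₚ.≟ s))
    receives m s = 𝟙 ((dst m ≟ q) ×-dec (time m ℕₚ.≟ s))
    weight : Msg n₁ d p → ℕ
    weight m = ∑ (upTo l) (λ s → sends m (a + s) + receives m (a + s))
    at-time : ∀ m → a ≤ time m → time m < b → sends m (time m) + receives m (time m) ≤ weight m
    at-time m a≤t t<b = begin
      sends m (time m) + receives m (time m)                                        ≡⟨ cong (λ t → sends m t + receives m t) (m+[n∸m]≡n a≤t) ⟨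
      sends m (a + (time m ∸ a)) + receives m (a + (time m ∸ a))                    ≤⟨ ∑-member (λ s → sends m (a + s) + receives m (a + s)) (∈-upTo⁺ (∸-monoˡ-< t<b a≤t)) ⟩
      weight m                                                                      ∎
    message : ∀ {u} → Pointwise _<_ u ls → ∀ j → owns q (cell (y ⊕ u)) ≢ owns q (cell (updateAt (y ⊕ u) j suc)) →
      ∃[ m ] (m ∈ msgs × node m ≡ cell (y ⊕ u) × 1 ≤ weight m)
    message {u} u< j χ≢ = by-cases (proc v ≟ q) (proc w ≟ q)
      where
      v w : Node n₁ d
      v = cell (y ⊕ u)
      w = cell (updateAt (y ⊕ u) j suc)
      arc : Arc v w
      arc = crossing-arc (owns q) (y ⊕ u) j χ≢
      v≢w : proc v ≢ proc w
      v≢w = proc≢ (λ q′ → does (q′ ≟ q)) χ≢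
      a≤v : a ≤ step v
      a≤v = step-mono (⊕-upper y u)
      w≤b : step w ≤ b
      w≤b = step-mono (<⇒updateAt-≤ (⊕-mono-< y u< (Pointwise.refl ≤-refl)) j)
      does-no : ∀ {P : Set} (P? : Dec P) → ¬ P → does P? ≡ false
      does-no (yes p) ¬p = contradiction p ¬p
      does-no (no _)  _  = refl
      by-cases : Dec (proc v ≡ q) → Dec (proc w ≡ q) → ∃[ m ] (m ∈ msgs × node m ≡ v × 1 ≤ weight m)
      by-cases (yes v≡q) _ with emitted arc v≢w
      ... | m , (m∈ , node≡ , after , before) , src≡ = m , m∈ , node≡ , (begin
        1                                              ≡⟨ 𝟙-yes ((src m ≟ q) ×-dec (time m ℕₚ.≟ time m)) (trans src≡ v≡q , refl) ⟨
        sends m (time m)                               ≤⟨ m≤m+n _ _ ⟩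
        sends m (time m) + receives m (time m)         ≤⟨ at-time m (≤-trans a≤v after) (<-≤-trans before w≤b) ⟩
        weight m                                       ∎)
      by-cases (no _) (yes w≡q) with received arc v≢w
      ... | m , (m∈ , node≡ , after , before) , dst≡ = m , m∈ , node≡ , (begin
        1                                              ≡⟨ 𝟙-yes ((dst m ≟ q) ×-dec (time m ℕₚ.≟ time m)) (trans dst≡ w≡q , refl) ⟨
        receives m (time m)                            ≤⟨ m≤n+m _ _ ⟩
        sends m (time m) + receives m (time m)         ≤⟨ at-time m (≤-trans a≤v after) (<-≤-trans before w≤b) ⟩
        weight m                                       ∎)
      by-cases (no v≢q) (no w≢q) = contradiction (trans (does-no (proc v ≟ q) v≢q) (sym (does-no (proc w ≟ q) w≢q))) χ≢
    inside : ∑ (box ls) (crossings Boolₚ._≟_ (λ u → owns q (cell (y ⊕ u)))) ≤ d * (2 * ∑ (upTo l) (λ s → h (a + s)))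
    inside = begin
      ∑ (box ls) (crossings Boolₚ._≟_ (λ u → owns q (cell (y ⊕ u))))
        ≤⟨ crossings≤messages Boolₚ._≟_ (owns q) weight fits message ⟩
      d * ∑ msgs weight
        ≡⟨ cong (d *_) (∑-swap msgs (upTo l) _) ⟩
      d * ∑ (upTo l) (λ s → ∑ msgs (λ m → sends m (a + s) + receives m (a + s)))
        ≡⟨ cong (d *_) (∑-cong (upTo l) (λ s → trans (∑-+ msgs _ _) (sym (cong₂ _+_ (length-filter _ msgs) (length-filter _ msgs))))) ⟩
      d * ∑ (upTo l) (λ s → sent q (a + s) + recv q (a + s))
        ≤⟨ *-monoʳ-≤ d (∑-mono (upTo l) (λ {s} _ → ≤-trans (+-mono-≤ (sent≤h q (a + s)) (recv≤h q (a + s))) (≤-reflexive (cong (h (a + s) +_) (sym (+-identityʳ _)))))) ⟩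
      d * ∑ (upTo l) (λ s → 2 * h (a + s))
        ≡⟨ cong (d *_) (∑-*ˡ (upTo l) 2 _) ⟩
      d * (2 * ∑ (upTo l) (λ s → h (a + s))) ∎

-- Communication bounds

^-distribʳ-* : ∀ m n o → (m * n) ^ o ≡ m ^ o * n ^ o
^-distribʳ-* m n zero    = refl
^-distribʳ-* m n (suc o) rewrite ^-distribʳ-* m n o = shuffle m n (m ^ o) (n ^ o)
  where
  shuffle : ∀ a b x y → (a * b) * (x * y) ≡ (a * x) * (b * y)
  shuffle = solve-∀

-- The search stops at the first failure after `m`. One change from true to false is all that is
-- wanted, since the share of a processor in a growing cube is not monotone.
last-true : ∀ {P : ℕ → Set} → Decidable P → ∀ m k → P m → ¬ P (m + k) → ∃[ r ] (m ≤ r × r < m + k × P r × ¬ P (suc r))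
last-true {P} P? m zero    Pm ¬P = contradiction (subst P (sym (+-identityʳ m)) Pm) ¬P
last-true {P} P? m (suc k) Pm ¬P with P? (suc m)
... | no ¬P′ = m , ≤-refl , m<m+n m (s≤s z≤n) , Pm , ¬P′
... | yes P′ with last-true P? (suc m) k P′ (subst (¬_ ∘ P) (+-suc m k) ¬P)
... | r , m<r , r< , Pr , ¬Pr = r , <⇒≤ m<r , subst (r <_) (sym (+-suc m k)) r< , Pr , ¬Pr

All-replicate : ∀ {P : ℕ → Set} d {a} → P a → All P (replicate d a)
All-replicate zero    Pa = []
All-replicate (suc d) Pa = Pa ∷ All-replicate d Pa

Pointwise-replicate : ∀ d {a b} → a ≤ b → Pointwise _≤_ (replicate d a) (replicate d b)
Pointwise-replicate zero    a≤b = []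
Pointwise-replicate (suc d) a≤b = a≤b ∷ Pointwise-replicate d a≤b

⊕-mono : ∀ {y z u v : Vec ℕ d} → Pointwise _≤_ y z → Pointwise _≤_ u v → Pointwise _≤_ (y ⊕ u) (z ⊕ v)
⊕-mono []       []       = []
⊕-mono (p ∷ ps) (q ∷ qs) = +-mono-≤ p q ∷ ⊕-mono ps qs

0⊕ : ∀ (u : Vec ℕ d) → replicate d 0 ⊕ u ≡ u
0⊕ = zipWith-identityˡ (λ _ → refl)

⊕-comm : ∀ (u v : Vec ℕ d) → u ⊕ v ≡ v ⊕ u
⊕-comm = zipWith-comm +-comm

diagonal-⊕ : ∀ t r (x : Vec ℕ d) → replicate d t ⊕ x ⊕ replicate d r ≡ replicate d (t + r) ⊕ x
diagonal-⊕ t r []      = refl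
diagonal-⊕ t r (i ∷ x) = cong₂ _∷_ (swap t i r) (diagonal-⊕ t r x)
  where
  swap : ∀ t i r → t + i + r ≡ t + r + i
  swap = solve-∀

∑-box-mono : ∀ {ls ms : Vec ℕ d} (f : Vec ℕ d → ℕ) → Pointwise _≤_ ls ms → ∑ (box ls) f ≤ ∑ (box ms) f
∑-box-mono {ls = ls} {ms} f ls≤ms = begin
  ∑ (box ls) f                             ≡⟨ ∑-cong (box ls) (λ u → cong f (sym (0⊕ u))) ⟩
  ∑ (box ls) (λ u → f (replicate _ 0 ⊕ u)) ≤⟨ ∑-box-window ls f (subst (λ v → Pointwise _≤_ v ms) (sym (0⊕ ls)) ls≤ms) ⟩
  ∑ (box ms) f                             ∎
  where open ≤-Reasoning

module Grid {k d p : ℕ} (E : Execution (suc k) d p) where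
  open Execution E
  open Communication E
  open Colouring

  0⃗ : Vec ℕ d
  0⃗ = replicate d 0

  fits-grid : Fits 0⃗ (replicate d n₁)
  fits-grid = subst (λ v → Pointwise _≤_ v (replicate d n₁)) (sym (0⊕ _)) (Pointwise.refl ≤-refl)

  prefix≤H : ∀ v → prefix (step v) ≤ H
  prefix≤H v = prefix-mono (<⇒≤ (step<S v))

  centred : ∀ {C : Set} _≟ᶜ_ (χ : Vec ℕ d → C) ls → ∑ (box ls) (crossings _≟ᶜ_ χ) ≡ ∑ (box ls) (crossings _≟ᶜ_ (λ u → χ (0⃗ ⊕ u)))
  centred _≟ᶜ_ χ ls = ∑-cong (box ls) (λ u → sym (trans (crossings-⊕ _≟ᶜ_ χ 0⃗ u) (cong (crossings _≟ᶜ_ χ) (0⊕ u))))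

  grid-crossings : ∑ (cube d n₁) (crossings _≟_ (proc ∘ cell)) ≤ d * (p * H)
  grid-crossings = ≤-trans (≤-reflexive (centred _≟_ (proc ∘ cell) (replicate d n₁))) (total-crossings fits-grid)

  grid-boundary : ∀ q → ∑ (cube d n₁) (crossings Boolₚ._≟_ (owns q ∘ cell)) ≤ 2 * d * H
  grid-boundary q = begin
    ∑ (cube d n₁) (crossings Boolₚ._≟_ (owns q ∘ cell))                                ≡⟨ centred Boolₚ._≟_ (owns q ∘ cell) (replicate d n₁) ⟩
    ∑ (cube d n₁) (crossings Boolₚ._≟_ (λ u → owns q (cell (0⃗ ⊕ u))))                 ≤⟨ m≤m+n _ _ ⟩
    _ + 2 * d * prefix (step (cell 0⃗))                                                ≤⟨ window-crossings q fits-grid ⟩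
    2 * d * prefix (step (cell (0⃗ ⊕ replicate d n₁)))                                 ≤⟨ *-monoʳ-≤ (2 * d) (prefix≤H _) ⟩
    2 * d * H                                                                         ∎
    where open ≤-Reasoning

  occupancy : Fin p → Vec ℕ d → ℕ → ℕ
  occupancy q y r = frequency _≟_ (λ u → proc (cell (y ⊕ u))) q (cube d r)

  owns-frequency : ∀ q (f : Vec ℕ d → Node n₁ d) us → frequency Boolₚ._≟_ (owns q ∘ f) true us ≡ ∑ us (λ u → 𝟙 (proc (f u) ≟ q))
  owns-frequency q f us = ∑-cong us pointwise
    where
    pointwise : ∀ u → 𝟙 (owns q (f u) Boolₚ.≟ true) ≡ 𝟙 (proc (f u) ≟ q)
    pointwise u with does (proc (f u) ≟ q)
    ... | true  = refl
    ... | false = refl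

-- Bounds from the boundary of one processor's share

module Loads {k e p : ℕ} (E : Execution (suc k) (suc e) p) where
  open Execution E
  open Communication E
  open Colouring
  open Grid E
  open ≤-Reasoning

  d₁ : ℕ
  d₁ = suc e

  -- With ε = `a / b` and `a < b`, at least a fraction `1 / b` of the grid lies outside the share of
  -- `q`, while the share itself exceeds a fraction `1 / T`. `colour-boundary` on the whole grid
  -- then gives a boundary of order `n₁ ^ e`.
  heavy-processor : ∀ q {a b T} → load q ≡ W → a < b → W * b ≤ a * n₁ ^ d₁ → n₁ ^ d₁ < T * W →
    n₁ ^ e ≤ 2 * d₁ * T * b * H
  heavy-processor q {a} {b} {T} load≡W a<b Wb≤ n^d<TW = *-cancelˡ-≤ n₁ (begin
    n₁ ^ d₁                               ≤⟨ <⇒≤ n^d<TW ⟩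
    T * W                                 ≤⟨ *-monoʳ-≤ T (*-cancelʳ-≤ W _ V {{m^n≢0 n₁ d₁}} W≤) ⟩
    T * (b * n₁ * X)                      ≤⟨ *-monoʳ-≤ T (*-monoʳ-≤ (b * n₁) (grid-boundary q)) ⟩
    T * (b * n₁ * (2 * d₁ * H))           ≡⟨ shuffle T b n₁ d₁ H ⟩
    n₁ * (2 * d₁ * T * b * H)             ∎)
    where
    V = n₁ ^ d₁
    X = ∑ (cube d₁ n₁) (crossings Boolₚ._≟_ (owns q ∘ cell))
    shuffle : ∀ T b n d h → T * (b * n * (2 * d * h)) ≡ n * (2 * d * T * b * h)
    shuffle = solve-∀
    swap : ∀ w b v → w * (b * v) ≡ b * (w * v)
    swap = solve-∀
    regroup : ∀ b n v x → b * (n * (v * x)) ≡ b * n * x * v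
    regroup = solve-∀
    complement : V ≤ b * (V ∸ W)
    complement = begin
      V                   ≤⟨ m+n≤o⇒m≤o∸n V (begin
        V + b * W         ≤⟨ +-monoʳ-≤ V (≤-trans (≤-reflexive (*-comm b W)) Wb≤) ⟩
        suc a * V         ≤⟨ *-monoˡ-≤ V a<b ⟩
        b * V             ∎) ⟩
      b * V ∸ b * W       ≡⟨ *-distribˡ-∸ b V W ⟨
      b * (V ∸ W)         ∎
    occupied : frequency Boolₚ._≟_ (owns q ∘ cell) true (cube d₁ n₁) ≡ W
    occupied = trans (owns-frequency q cell (cube d₁ n₁)) (trans (sym (load-cube q)) load≡W)
    W≤ : W * V ≤ b * n₁ * X * V
    W≤ = begin
      W * V                        ≤⟨ *-monoʳ-≤ W complement ⟩
      W * (b * (V ∸ W))            ≡⟨ swap W b (V ∸ W) ⟩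
      b * (W * (V ∸ W))            ≤⟨ *-monoʳ-≤ b (subst₂ (λ w v → w * (v ∸ w) ≤ n₁ * (v * X)) occupied (length-cube d₁ n₁)
                                        (colour-boundary Boolₚ._≟_ (replicate d₁ n₁) (owns q ∘ cell) true (All-replicate d₁ ≤-refl))) ⟩
      b * (n₁ * (V * X))           ≡⟨ regroup b n₁ V X ⟩
      b * n₁ * X * V               ∎

  -- Cut the grid into boxes of volume about 2W: in each of them q is a minority, so its boundary there is at least
  -- its share divided by the side.
  load-bound : ∀ q → load q ≡ W → 0 < W → 2 * W ≤ n₁ ^ d₁ → W ^ e ≤ (32 * d₁ * H) ^ d₁
  load-bound q load≡W 0<W 2W≤ with last-true (λ j → j ^ d₁ <? 2 * W) 0 n₁ (≤-trans 0<W (m≤m+n W _)) (≤⇒≯ 2W≤)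
  -- Excluding `j = 0` yields `r ≤ 2 * j` below, so that `r ^ d₁` is at most a constant times `W`.
  ... | zero , _ , _ , _ , ¬1< = contradiction (<-≤-trans (s≤s (≤-reflexive (^-zeroˡ d₁))) (*-monoʳ-≤ 2 0<W)) ¬1<
  -- A factor `W` is restored: `W` is at most a multiple of `H * r`, and `r ^ d₁` at most a multiple
  -- of `W`, so it cancels and no root is taken.
  ... | j@(suc _) , _ , j<n , j^d< , ¬r^d< = *-cancelʳ-≤ (W ^ e) _ W {{>-nonZero 0<W}} (begin
    W ^ e * W                                      ≡⟨ *-comm (W ^ e) W ⟩
    W ^ d₁                                         ≤⟨ ^-monoˡ-≤ d₁ W≤ ⟩
    (4 * r * (2 * d₁ * H)) ^ d₁                    ≡⟨ cong (_^ d₁) (shuffle r d₁ H) ⟩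
    (8 * d₁ * H * r) ^ d₁                          ≡⟨ ^-distribʳ-* (8 * d₁ * H) r d₁ ⟩
    (8 * d₁ * H) ^ d₁ * r ^ d₁                     ≤⟨ *-monoʳ-≤ ((8 * d₁ * H) ^ d₁) r^d≤ ⟩
    (8 * d₁ * H) ^ d₁ * (4 ^ d₁ * W)               ≡⟨ *-assoc ((8 * d₁ * H) ^ d₁) (4 ^ d₁) W ⟨
    (8 * d₁ * H) ^ d₁ * 4 ^ d₁ * W                 ≡⟨ cong (_* W) (^-distribʳ-* (8 * d₁ * H) 4 d₁) ⟨
    (8 * d₁ * H * 4) ^ d₁ * W                      ≡⟨ cong (λ z → z ^ d₁ * W) (shuffle₂ d₁ H) ⟩
    (32 * d₁ * H) ^ d₁ * W                         ∎)
    where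
    r = suc j
    shuffle : ∀ r d h → 4 * r * (2 * d * h) ≡ 8 * d * h * r
    shuffle = solve-∀
    shuffle₂ : ∀ d h → 8 * d * h * 4 ≡ 32 * d * h
    shuffle₂ = solve-∀
    r≤2j : r ≤ 2 * j
    r≤2j = ≤-trans (+-monoˡ-≤ j (s≤s z≤n)) (≤-reflexive (cong (j +_) (sym (+-identityʳ j))))
    r^d≤ : r ^ d₁ ≤ 4 ^ d₁ * W
    r^d≤ = begin
      r ^ d₁                        ≤⟨ ^-monoˡ-≤ d₁ r≤2j ⟩
      (2 * j) ^ d₁                  ≡⟨ ^-distribʳ-* 2 j d₁ ⟩
      2 ^ d₁ * j ^ d₁               ≤⟨ *-monoʳ-≤ (2 ^ d₁) (<⇒≤ j^d<) ⟩
      2 ^ d₁ * (2 * W)              ≡⟨ *-assoc (2 ^ d₁) 2 W ⟨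
      2 ^ d₁ * 2 * W                ≤⟨ *-monoˡ-≤ W (*-monoʳ-≤ (2 ^ d₁) (^-monoʳ-≤ 2 {1} {d₁} (s≤s z≤n))) ⟩
      2 ^ d₁ * 2 ^ d₁ * W           ≡⟨ cong (_* W) (^-distribʳ-* 2 2 d₁) ⟨
      4 ^ d₁ * W                    ∎
    χ : Vec ℕ d₁ → Bool
    χ = owns q ∘ cell
    W≤ : W ≤ 4 * r * (2 * d₁ * H)
    W≤ = begin
      W                                                               ≡⟨ load≡W ⟨
      load q                                                          ≡⟨ load-cube q ⟩
      ∑ (cube d₁ n₁) (λ u → 𝟙 (proc (cell u) ≟ q))                    ≤⟨ ∑-cube-split d₁ (s≤s z≤n) j<n _ _ piece ⟩
      ∑ (cube d₁ n₁) (λ u → 4 * r * crossings Boolₚ._≟_ χ u)          ≡⟨ ∑-*ˡ (cube d₁ n₁) (4 * r) _ ⟩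
      4 * r * ∑ (cube d₁ n₁) (crossings Boolₚ._≟_ χ)                  ≤⟨ *-monoʳ-≤ (4 * r) (grid-boundary q) ⟩
      4 * r * (2 * d₁ * H)                                            ∎
      where
      piece : ∀ y (ls : Vec ℕ d₁) → All (r ≤_) ls → All (_≤ 2 * r) ls → Fits y ls →
        ∑ (box ls) (λ u → 𝟙 (proc (cell (y ⊕ u)) ≟ q)) ≤ ∑ (box ls) (λ u → 4 * r * crossings Boolₚ._≟_ χ (y ⊕ u))
      piece y ls r≤ ≤2r fits = begin
        ∑ (box ls) (λ u → 𝟙 (proc (cell (y ⊕ u)) ≟ q))
          ≡⟨ occ≡ ⟨
        frequency Boolₚ._≟_ (χ ∘ (y ⊕_)) true (box ls)
          ≤⟨ minority-boundary Boolₚ._≟_ ls (χ ∘ (y ⊕_)) true ≤2r minority ⟩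
        2 * (2 * r) * ∑ (box ls) (crossings Boolₚ._≟_ (χ ∘ (y ⊕_)))
          ≡⟨ cong₂ _*_ (sym (*-assoc 2 2 r)) (∑-cong (box ls) (crossings-⊕ Boolₚ._≟_ χ y)) ⟩
        4 * r * ∑ (box ls) (λ u → crossings Boolₚ._≟_ χ (y ⊕ u))
          ≡⟨ ∑-*ˡ (box ls) (4 * r) _ ⟨
        ∑ (box ls) (λ u → 4 * r * crossings Boolₚ._≟_ χ (y ⊕ u)) ∎
        where
        occ≡ = owns-frequency q (λ u → cell (y ⊕ u)) (box ls)
        minority : 2 * frequency Boolₚ._≟_ (χ ∘ (y ⊕_)) true (box ls) ≤ length (box ls)
        minority = begin
          2 * frequency Boolₚ._≟_ (χ ∘ (y ⊕_)) true (box ls)     ≡⟨ cong (2 *_) occ≡ ⟩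
          2 * ∑ (box ls) (λ u → 𝟙 (proc (cell (y ⊕ u)) ≟ q))     ≤⟨ *-monoʳ-≤ 2 (occupancy≤W q fits) ⟩
          2 * W                                                  ≤⟨ ≮⇒≥ ¬r^d< ⟩
          r ^ d₁                                                 ≤⟨ length-box-≥ ls r≤ ⟩
          length (box ls)                                        ∎

  -- `2 ^ d₁` is the loss from `r ≤ 2 * j`, one factor 2 comes from the majority and one from
  -- `minority-boundary`; `2 * d₁` is the constant of `window-crossings`.
  κ : ℕ
  κ = 2 ^ (2 + d₁) * (2 * d₁)

  -- Grow a cube until q just loses its majority: at that side its density is still bounded below.
  grow : ∀ q {y m R} → 0 < m → m ≤ R → m ^ d₁ < 2 * occupancy q y m → 2 * W ≤ R ^ d₁ → Fits y (replicate d₁ R) →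
    ∃[ r ] (m < r × r ≤ R × r ^ e + κ * prefix (step (cell y)) ≤ κ * prefix (step (cell (y ⊕ replicate d₁ r))))
  grow q {y} {m} {R} 0<m m≤R major 2W≤ fits
    -- The majority is lost by side `R` at the latest, since `q` has at most `W` nodes and
    -- `2 * W ≤ R ^ d₁`.
    with last-true (λ j → j ^ d₁ <? 2 * occupancy q y j) m (R ∸ m) major
           (subst (λ z → ¬ z ^ d₁ < 2 * occupancy q y z) (sym (m+[n∸m]≡n m≤R)) (≤⇒≯ (≤-trans (*-monoʳ-≤ 2 (occupancy≤W q fits)) 2W≤)))
  ... | j , m≤j , j<R , j^d< , ¬r^d< = r , s≤s m≤j , r≤R , (begin
    r ^ e + κ * Pa                                ≤⟨ +-monoˡ-≤ (κ * Pa) r^e≤ ⟩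
    2 ^ (2 + d₁) * X + 2 ^ (2 + d₁) * (2 * d₁) * Pa   ≡⟨ factor (2 ^ (2 + d₁)) X (2 * d₁) Pa ⟩
    2 ^ (2 + d₁) * (X + 2 * d₁ * Pa)                ≤⟨ *-monoʳ-≤ (2 ^ (2 + d₁)) (window-crossings q fits-r) ⟩
    2 ^ (2 + d₁) * (2 * d₁ * Pb)                    ≡⟨ *-assoc (2 ^ (2 + d₁)) (2 * d₁) Pb ⟨
    κ * Pb                                        ∎)
    where
    r = suc j
    Pa = prefix (step (cell y))
    Pb = prefix (step (cell (y ⊕ replicate d₁ r)))
    r≤R : r ≤ R
    r≤R = subst (r ≤_) (m+[n∸m]≡n m≤R) j<R
    fits-r : Fits y (replicate d₁ r)
    fits-r = Pointwise.trans ≤-trans (⊕-mono {y = y} (Pointwise.refl ≤-refl) (Pointwise-replicate d₁ r≤R)) fits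
    χ : Vec ℕ d₁ → Bool
    χ u = owns q (cell (y ⊕ u))
    X = ∑ (cube d₁ r) (crossings Boolₚ._≟_ χ)
    occ = occupancy q y r
    factor : ∀ c x t s → c * x + c * t * s ≡ c * (x + t * s)
    factor = solve-∀
    occ≤ : occ ≤ 2 * r * X
    occ≤ = subst (_≤ 2 * r * X) occ≡ (minority-boundary Boolₚ._≟_ (replicate d₁ r) χ true (All-replicate d₁ ≤-refl)
      (subst₂ (λ a v → 2 * a ≤ v) (sym occ≡) (sym (length-cube d₁ r)) (≮⇒≥ ¬r^d<)))
      where occ≡ = owns-frequency q (λ u → cell (y ⊕ u)) (cube d₁ r)
    r≤2j : r ≤ 2 * j
    r≤2j = ≤-trans (+-monoˡ-≤ j (≤-trans 0<m m≤j)) (≤-reflexive (cong (j +_) (sym (+-identityʳ j))))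
    shuffle : ∀ c r x → c * (2 * (2 * r * x)) ≡ r * (2 * (2 * c) * x)
    shuffle = solve-∀
    -- From side `j` to side `r` the share of `q` does not shrink, while the volume grows at most by
    -- the factor `2 ^ d₁`. So `q` is a minority of density bounded below.
    r^e≤ : r ^ e ≤ 2 ^ (2 + d₁) * X
    r^e≤ = *-cancelˡ-≤ r (begin
      r ^ d₁                                ≤⟨ ^-monoˡ-≤ d₁ r≤2j ⟩
      (2 * j) ^ d₁                          ≡⟨ ^-distribʳ-* 2 j d₁ ⟩
      2 ^ d₁ * j ^ d₁                       ≤⟨ *-monoʳ-≤ (2 ^ d₁) (<⇒≤ j^d<) ⟩
      2 ^ d₁ * (2 * occupancy q y j)        ≤⟨ *-monoʳ-≤ (2 ^ d₁) (*-monoʳ-≤ 2 (∑-box-mono _ (Pointwise-replicate d₁ (n≤1+n j)))) ⟩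
      2 ^ d₁ * (2 * occ)                    ≤⟨ *-monoʳ-≤ (2 ^ d₁) (*-monoʳ-≤ 2 occ≤) ⟩
      2 ^ d₁ * (2 * (2 * r * X))            ≡⟨ shuffle (2 ^ d₁) r X ⟩
      r * (2 ^ (2 + d₁) * X)                ∎)

-- Cubes along diagonals

module Diagonal {k e p : ℕ} (E : Execution (suc k) (suc e) p) {m N : ℕ}
  (0<m : 0 < m) (m≤2N : m ≤ 2 * N) (0<N : 0 < N) (8N≤n : 8 * N ≤ suc k)
  (2W≤ : 2 * Execution.W E ≤ (2 * N) ^ suc e) where

  open Execution E
  open Communication E
  open Colouring
  open Grid E
  open Loads E
  open ≤-Reasoning

  -- A positive answer means that some processor has a strict majority in the cube at `y`;
  -- `contested` is the indicator of the negative answer.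
  contested? : ∀ y → Dec (∃[ q ] m ^ d₁ < 2 * occupancy q y m)
  contested? y = any? (λ q → m ^ d₁ <? 2 * occupancy q y m)

  contested : Vec ℕ d₁ → ℕ
  contested y = 𝟙 (¬? (contested? y))

  on-diagonal : Vec ℕ d₁ → ℕ → Vec ℕ d₁
  on-diagonal x t = replicate d₁ t ⊕ x

  m^d≢0 : NonZero (m ^ d₁)
  m^d≢0 = m^n≢0 m d₁ {{>-nonZero 0<m}}

  contested-crossings : ∀ y → contested y * m ^ d₁ ≤ 2 * m * ∑ (cube d₁ m) (λ u → crossings _≟_ (proc ∘ cell) (y ⊕ u))
  contested-crossings y with contested? y
  ... | yes _ = z≤n
  ... | no minor = begin
    1 * V                                                                  ≡⟨ *-identityˡ V ⟩
    V                                                                      ≤⟨ *-cancelˡ-≤ V {{m^d≢0}} (subst (λ v → v * v ≤ v * (2 * m * X)) (length-cube d₁ m)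
                                                                                (no-majority _≟_ (replicate d₁ m) (λ u → proc (cell (y ⊕ u))) (All-replicate d₁ ≤-refl) minority)) ⟩
    2 * m * X                                                              ≡⟨ cong (2 * m *_) (∑-cong (cube d₁ m) (crossings-⊕ _≟_ (proc ∘ cell) y)) ⟩
    2 * m * ∑ (cube d₁ m) (λ u → crossings _≟_ (proc ∘ cell) (y ⊕ u))      ∎
    where
    V = m ^ d₁
    X = ∑ (cube d₁ m) (crossings _≟_ (λ u → proc (cell (y ⊕ u))))
    minority : ∀ q → 2 * occupancy q y m ≤ length (cube d₁ m)
    minority q = subst (2 * occupancy q y m ≤_) (sym (length-cube d₁ m)) (≮⇒≥ (λ major → minor (q , major)))

  -- For a fixed offset `u` the points `y ⊕ u` form one box of the grid, so each of the `m ^ d₁`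
  -- offsets contributes at most all crossing arcs. This factor cancels against the volume in
  -- `contested-crossings`.
  contested-total : ∑ (cube d₁ (4 * N)) contested ≤ 2 * m * (d₁ * (p * H))
  contested-total = *-cancelʳ-≤ _ _ V {{m^d≢0}} (begin
    ∑ (cube d₁ (4 * N)) contested * V
      ≡⟨ ∑-*ʳ (cube d₁ (4 * N)) V contested ⟨
    ∑ (cube d₁ (4 * N)) (λ y → contested y * V)
      ≤⟨ ∑-mono (cube d₁ (4 * N)) (λ {y} _ → contested-crossings y) ⟩
    ∑ (cube d₁ (4 * N)) (λ y → 2 * m * ∑ (cube d₁ m) (λ u → c (y ⊕ u)))
      ≡⟨ trans (∑-*ˡ (cube d₁ (4 * N)) (2 * m) _) (cong (2 * m *_) (∑-swap (cube d₁ (4 * N)) (cube d₁ m) _)) ⟩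
    2 * m * ∑ (cube d₁ m) (λ u → ∑ (cube d₁ (4 * N)) (λ y → c (y ⊕ u)))
      ≤⟨ *-monoʳ-≤ (2 * m) (∑-mono (cube d₁ m) (λ {u} u∈ → translated u (∈-box⁻ _ u∈))) ⟩
    2 * m * ∑ (cube d₁ m) (λ _ → d₁ * (p * H))
      ≡⟨ cong (2 * m *_) (trans (∑-const (cube d₁ m) _) (cong (_* (d₁ * (p * H))) (length-cube d₁ m))) ⟩
    2 * m * (V * (d₁ * (p * H)))
      ≡⟨ shuffle (2 * m) V (d₁ * (p * H)) ⟩
    2 * m * (d₁ * (p * H)) * V ∎)
    where
    V = m ^ d₁
    c = crossings _≟_ (proc ∘ cell)
    shuffle : ∀ a v b → a * (v * b) ≡ a * b * v
    shuffle = solve-∀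
    m+4N≤n : m + 4 * N ≤ n₁
    m+4N≤n = ≤-trans (+-monoˡ-≤ (4 * N) m≤2N) (≤-trans (≤-reflexive (sym (*-distribʳ-+ N 2 4))) (≤-trans (*-monoˡ-≤ N (m≤m+n 6 2)) 8N≤n))
    translated : ∀ u → Pointwise _<_ u (replicate d₁ m) → ∑ (cube d₁ (4 * N)) (λ y → c (y ⊕ u)) ≤ d₁ * (p * H)
    translated u u<m = begin
      ∑ (cube d₁ (4 * N)) (λ y → c (y ⊕ u))      ≡⟨ ∑-cong (cube d₁ (4 * N)) (λ y → cong c (⊕-comm y u)) ⟩
      ∑ (cube d₁ (4 * N)) (λ y → c (u ⊕ y))      ≤⟨ ∑-box-window (replicate d₁ (4 * N)) c inside ⟩
      ∑ (cube d₁ n₁) c                           ≤⟨ grid-crossings ⟩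
      d₁ * (p * H)                               ∎
      where
      inside : Fits u (replicate d₁ (4 * N))
      inside = Pointwise.trans ≤-trans (⊕-mono {u = replicate d₁ (4 * N)} (Pointwise.map <⇒≤ u<m) (Pointwise.refl ≤-refl))
        (subst (λ v → Pointwise _≤_ v (replicate d₁ n₁)) (sym (zipWith-replicate _+_ m (4 * N))) (Pointwise-replicate d₁ m+4N≤n))

  module Along {f : ℕ} (e≡ : e ≡ suc f) where

    -- The price of one step along the diagonal: a grown cube of side `r > m` earns `r ^ e`, which
    -- is at least `μ * r`, whatever its side.
    μ : ℕ
    μ = m ^ f

    module Walk {x : Vec ℕ d₁} (x<N : Pointwise _<_ x (replicate d₁ N)) where

      pos : ℕ → Vec ℕ d₁
      pos = on-diagonal x

      time-at : ℕ → ℕ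
      time-at t = prefix (step (cell (pos t)))

      -- A cube without majority is stepped over singly and counted; any other cube is grown and leapt over,
      -- which is paid for by the communication during its evaluation.
      Reached : ℕ → Set
      Reached t = μ * t ≤ κ * time-at t + μ * ∑ (upTo t) (contested ∘ pos)

      fits-walk : ∀ {t} → t < N → Fits (pos t) (replicate d₁ (2 * N))
      fits-walk {t} t<N = subst (λ v → Pointwise _≤_ v (replicate d₁ n₁)) (sym (diagonal-⊕ t (2 * N) x))
        (Pointwise.trans ≤-trans (⊕-mono (Pointwise-replicate d₁ (+-monoˡ-≤ (2 * N) (<⇒≤ t<N))) (Pointwise.map <⇒≤ x<N))
          (subst (λ v → Pointwise _≤_ v (replicate d₁ n₁)) (sym (zipWith-replicate _+_ (N + 2 * N) N)) (Pointwise-replicate d₁ 4N≤n)))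
        where
        4N≡ : ∀ N → N + 2 * N + N ≡ 4 * N
        4N≡ = solve-∀
        4N≤n : N + 2 * N + N ≤ n₁
        4N≤n = ≤-trans (≤-reflexive (4N≡ N)) (≤-trans (*-monoˡ-≤ N (m≤m+n 4 4)) 8N≤n)

      Stride : ℕ → Set
      Stride t = ∃[ t′ ] (t < t′ × t′ ≤ t + 2 * N × Reached t′)

      long-stride : ∀ {t} → t < N → Reached t → ∃[ q ] m ^ d₁ < 2 * occupancy q (pos t) m → Stride t
      long-stride {t} t<N reached (q , major) = extend (grow q 0<m m≤2N major 2W≤ (fits-walk t<N))
        where
        charge : ℕ → ℕ
        charge t = μ * ∑ (upTo t) (contested ∘ pos)
        rotate : ∀ a b c → a + b + c ≡ c + a + b
        rotate = solve-∀
        μr≤ : ∀ {r} → m < r → μ * r ≤ r ^ e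
        μr≤ {r} m<r = begin
          m ^ f * r      ≤⟨ *-monoˡ-≤ r (^-monoˡ-≤ f (<⇒≤ m<r)) ⟩
          r ^ f * r      ≡⟨ *-comm (r ^ f) r ⟩
          r ^ suc f      ≡⟨ cong (r ^_) (sym e≡) ⟩
          r ^ e          ∎
        extend : ∃[ r ] (m < r × r ≤ 2 * N × r ^ e + κ * time-at t ≤ κ * prefix (step (cell (pos t ⊕ replicate d₁ r)))) → Stride t
        extend (r , m<r , r≤2N , gain) = t + r , m<m+n t (≤-trans 0<m (<⇒≤ m<r)) , +-monoʳ-≤ t r≤2N , (begin
          μ * (t + r)                                            ≡⟨ *-distribˡ-+ μ t r ⟩
          μ * t + μ * r                                          ≤⟨ +-mono-≤ reached (μr≤ m<r) ⟩
          κ * time-at t + charge t + r ^ e                            ≡⟨ rotate (κ * time-at t) (charge t) (r ^ e) ⟩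
          (r ^ e + κ * time-at t) + charge t                          ≤⟨ +-mono-≤ gain (*-monoʳ-≤ μ (∑-upTo-window {0} t (contested ∘ pos) (m≤m+n t r))) ⟩
          κ * prefix (step (cell (pos t ⊕ replicate d₁ r))) + charge (t + r)
                                                                 ≡⟨ cong (λ v → κ * prefix (step (cell v)) + charge (t + r)) (diagonal-⊕ t r x) ⟩
          κ * time-at (t + r) + charge (t + r)                        ∎)

      short-stride : ∀ {t} → Reached t → ¬ (∃[ q ] m ^ d₁ < 2 * occupancy q (pos t) m) → Stride t
      short-stride {t} reached minor = t + 1 , m<m+n t (s≤s z≤n) , +-monoʳ-≤ t (≤-trans 0<N (m≤m+n N _)) , (begin
        μ * (t + 1)                                                           ≡⟨ *-distribˡ-+ μ t 1 ⟩
        μ * t + μ * 1                                                         ≤⟨ +-monoˡ-≤ (μ * 1) reached ⟩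
        κ * time-at t + μ * ∑ (upTo t) (contested ∘ pos) + μ * 1              ≤⟨ +-monoˡ-≤ (μ * 1) (+-monoˡ-≤ _ (*-monoʳ-≤ κ later)) ⟩
        κ * time-at (t + 1) + μ * ∑ (upTo t) (contested ∘ pos) + μ * 1        ≡⟨ factor (κ * time-at (t + 1)) μ (∑ (upTo t) (contested ∘ pos)) ⟩
        κ * time-at (t + 1) + μ * (∑ (upTo t) (contested ∘ pos) + 1)          ≡⟨ cong (λ z → κ * time-at (t + 1) + μ * z) extended ⟨
        κ * time-at (t + 1) + μ * ∑ (upTo (t + 1)) (contested ∘ pos)          ∎)
        where
        factor : ∀ a m s → a + m * s + m * 1 ≡ a + m * (s + 1)
        factor = solve-∀
        later : time-at t ≤ time-at (t + 1)
        later = prefix-mono (step-mono (⊕-mono (Pointwise-replicate d₁ (m≤m+n t 1)) (Pointwise.refl ≤-refl)))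
        extended : ∑ (upTo (t + 1)) (contested ∘ pos) ≡ ∑ (upTo t) (contested ∘ pos) + 1
        extended = trans (∑-upTo-+ t 1 (contested ∘ pos)) (cong (∑ (upTo t) (contested ∘ pos) +_)
          (trans (+-identityʳ _) (trans (cong (contested ∘ pos) (+-identityʳ t)) (𝟙-yes (¬? (contested? (pos t))) minor))))

      stride : ∀ {t} → t < N → Reached t → Stride t
      stride {t} t<N reached = by-cases (contested? (pos t))
        where
        by-cases : Dec (∃[ q ] m ^ d₁ < 2 * occupancy q (pos t) m) → Stride t
        by-cases (yes major) = long-stride t<N reached major
        by-cases (no minor)  = short-stride reached minor

      -- Strides have unknown lengths, so the induction is on a lower bound `k` for the position. A
      -- stride is made only from `t = k`, which limits the overshoot to a single stride.
      walk : ∀ k → k ≤ N → ∃[ t ] (k ≤ t × t ≤ k + 2 * N × Reached t)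
      walk zero    _   = 0 , z≤n , z≤n , ≤-trans (≤-reflexive (*-zeroʳ μ)) z≤n
      walk (suc k) k<N with walk k (<⇒≤ k<N)
      ... | t , k≤t , t≤ , reached with m≤n⇒m<n∨m≡n k≤t
      ...   | inj₁ k<t = t , k<t , m≤n⇒m≤1+n t≤ , reached
      ...   | inj₂ refl with stride k<N reached
      ...     | t′ , k<t′ , t′≤ , reached′ = t′ , k<t′ , m≤n⇒m≤1+n t′≤ , reached′

      crossing-time : μ * N ≤ κ * H + μ * ∑ (upTo (3 * N)) (contested ∘ pos)
      crossing-time with walk N ≤-refl
      ... | t , N≤t , t≤3N , reached = begin
        μ * N                                                      ≤⟨ *-monoʳ-≤ μ N≤t ⟩
        μ * t                                                      ≤⟨ reached ⟩
        κ * time-at t + μ * ∑ (upTo t) (contested ∘ pos)           ≤⟨ +-mono-≤ (*-monoʳ-≤ κ (prefix≤H _)) (*-monoʳ-≤ μ (∑-upTo-window {0} t (contested ∘ pos) t≤3N)) ⟩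
        κ * H + μ * ∑ (upTo (3 * N)) (contested ∘ pos)             ∎

    -- Summing over all starting points replaces the choice of a good diagonal. At each `t` the
    -- positions form a translate of the starting cube, so cubes without majority cost at most
    -- `3 * N` times `contested-total`; the hypothesis on `m` and `p` makes this at most a constant
    -- times `N ^ d₁ * H`.
    diagonal-bound : m ^ e * p ≤ (16 * N) ^ e → μ * N ≤ (κ + 6 * d₁ * 16 ^ e) * H
    diagonal-bound m^ep≤ = *-cancelˡ-≤ (N ^ d₁) {{m^n≢0 N d₁ {{>-nonZero 0<N}}}} (begin
      N ^ d₁ * (μ * N)
        ≡⟨ trans (∑-const (cube d₁ N) (μ * N)) (cong (_* (μ * N)) (length-cube d₁ N)) ⟨
      ∑ (cube d₁ N) (const (μ * N))
        ≤⟨ ∑-mono (cube d₁ N) (λ {x} x∈ → Walk.crossing-time {x} (∈-box⁻ _ x∈)) ⟩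
      ∑ (cube d₁ N) (λ x → κ * H + μ * ∑ (upTo (3 * N)) (contested ∘ on-diagonal x))
        ≡⟨ trans (∑-+ (cube d₁ N) _ _) (cong₂ _+_ (trans (∑-const (cube d₁ N) _) (cong (_* (κ * H)) (length-cube d₁ N)))
             (trans (∑-*ˡ (cube d₁ N) μ _) (cong (μ *_) (∑-swap (cube d₁ N) (upTo (3 * N)) _)))) ⟩
      N ^ d₁ * (κ * H) + μ * ∑ (upTo (3 * N)) (λ t → ∑ (cube d₁ N) (λ x → contested (on-diagonal x t)))
        ≤⟨ +-monoʳ-≤ _ (*-monoʳ-≤ μ (∑-mono (upTo (3 * N)) (λ t∈ → translated (<⇒≤ (∈-upTo⁻ t∈))))) ⟩
      N ^ d₁ * (κ * H) + μ * ∑ (upTo (3 * N)) (λ _ → 2 * m * (d₁ * (p * H)))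
        ≡⟨ cong (λ z → N ^ d₁ * (κ * H) + μ * z) (∑-upTo-const (3 * N) _) ⟩
      N ^ d₁ * (κ * H) + μ * (3 * N * (2 * m * (d₁ * (p * H))))
        ≡⟨ cong (N ^ d₁ * (κ * H) +_) (shuffle μ N m d₁ p H) ⟩
      N ^ d₁ * (κ * H) + 6 * d₁ * N * H * (m * μ * p)
        ≡⟨ cong (λ z → N ^ d₁ * (κ * H) + 6 * d₁ * N * H * (m ^ z * p)) e≡ ⟨
      N ^ d₁ * (κ * H) + 6 * d₁ * N * H * (m ^ e * p)
        ≤⟨ +-monoʳ-≤ (N ^ d₁ * (κ * H)) (*-monoʳ-≤ (6 * d₁ * N * H) (≤-trans m^ep≤ (≤-reflexive (^-distribʳ-* 16 N e)))) ⟩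
      N ^ d₁ * (κ * H) + 6 * d₁ * N * H * (16 ^ e * N ^ e)
        ≡⟨ collect N (N ^ e) κ H d₁ (16 ^ e) ⟩
      N ^ d₁ * ((κ + 6 * d₁ * 16 ^ e) * H) ∎)
      where
      shuffle : ∀ μ N m d p H → μ * (3 * N * (2 * m * (d * (p * H)))) ≡ 6 * d * N * H * (m * μ * p)
      shuffle = solve-∀
      collect : ∀ N M κ H d s → N * M * (κ * H) + 6 * d * N * H * (s * M) ≡ N * M * ((κ + 6 * d * s) * H)
      collect = solve-∀
      translated : ∀ {t} → t ≤ 3 * N → ∑ (cube d₁ N) (λ x → contested (on-diagonal x t)) ≤ 2 * m * (d₁ * (p * H))
      translated {t} t≤3N = ≤-trans (∑-box-window (replicate d₁ N) contested
        (subst (λ v → Pointwise _≤_ v (replicate d₁ (4 * N))) (sym (zipWith-replicate _+_ t N))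
          (Pointwise-replicate d₁ (≤-trans (+-monoˡ-≤ N t≤3N) (≤-reflexive (+-comm (3 * N) N)))))) contested-total

-- Up to the factor 8, suc j is the side at which the grid splits into p diagonal lines of cubes.
critical-side : ∀ {n p} f → 0 < n → 0 < p → p ≤ n ^ suc f → ∃[ j ]
  (8 * j < n × n ^ suc f ≤ (8 * suc j) ^ suc f * p × suc j ^ suc f * p ≤ n ^ suc f)
critical-side {n} {p} f 0<n 0<p p≤ with last-true (λ j → (8 * j) ^ suc f * p <? n ^ suc f) 0 n
    (m^n>0 n {{>-nonZero 0<n}} (suc f))
    (≤⇒≯ (≤-trans (^-monoˡ-≤ (suc f) (m≤m+n n _)) (m≤m*n _ p {{>-nonZero 0<p}})))
... | j , _ , _ , below , above = j , 8j<n , ≮⇒≥ above , side j below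
  where
  8j<n : 8 * j < n
  8j<n = ≰⇒> (λ n≤8j → <⇒≱ below (≤-trans (^-monoˡ-≤ (suc f) n≤8j) (m≤m*n _ p {{>-nonZero 0<p}})))
  side : ∀ j → (8 * j) ^ suc f * p < n ^ suc f → suc j ^ suc f * p ≤ n ^ suc f
  -- With many processors the cubes shrink to single nodes; here `p ≤ n ^ suc f` enters.
  side zero      _     = ≤-trans (≤-reflexive (trans (cong (_* p) (^-zeroˡ (suc f))) (*-identityˡ p))) p≤
  side j@(suc _) below = ≤-trans (*-monoˡ-≤ p (^-monoˡ-≤ (suc f) 1+j≤8j)) (<⇒≤ below)
    where
    1+j≤8j : suc j ≤ 8 * j
    1+j≤8j = ≤-trans (≤-reflexive (+-comm 1 j)) (+-monoʳ-≤ j (s≤s z≤n))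

-- `N` is the unit of the walk: starting points below `N`, a path of length at most `3 * N` and
-- cubes of side at most `2 * N` all stay inside the grid.
eighth : ∀ {n} → 8 ≤ n → ∃[ N ] (0 < N × 8 * N ≤ n × n < 8 * suc N)
eighth {n} 8≤n = n / 8 , positive (n / 8) below , ≤-trans (m≤n+m (8 * (n / 8)) (n % 8)) (≤-reflexive (sym n≡)) , below
  where
  n≡ : n ≡ n % 8 + 8 * (n / 8)
  n≡ = trans (m≡m%n+[m/n]*n n 8) (cong (n % 8 +_) (*-comm (n / 8) 8))
  below : n < 8 * suc (n / 8)
  below = subst₂ _<_ (sym n≡) (sym (*-suc 8 (n / 8))) (+-monoˡ-< (8 * (n / 8)) (m%n<n n 8))
  positive : ∀ N → n < 8 * suc N → 0 < N
  positive zero    n<8 = contradiction 8≤n (<⇒≱ n<8)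
  positive (suc N) _   = s≤s z≤n

-- `a / b` stands for ε. Roots are cleared by raising the first bound to the power `d ∸ 1` and the
-- second to the power `d`; together they bound the sum with the constant doubled. `k` and `n₀` are
-- chosen before `n`, `p` and `E`.
theorem2 : (d : ℕ) → 1 < d → (a b : ℕ) → 0 < a → a < b →
    ∃[ k ] ∃[ n₀ ] ((n p : ℕ) → n₀ ≤ n → 1 < p → p ≤ n ^ (d ∸ 1) →
    (E : Execution n d p) → Execution.W E * b ≤ a * n ^ d →
    ((n ^ (d ∸ 1)) ^ (d ∸ 1) ≤ (suc k * Execution.H E) ^ (d ∸ 1) * p ^ (d ∸ 2))
    × (Execution.W E ^ (d ∸ 1) ≤ (suc k * Execution.H E) ^ d))
theorem2 (suc (suc f)) (s≤s (s≤s z≤n)) a b 0<a a<b = K₁ + K₂ + K₃ , 8 , bounds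
  where
  open ≤-Reasoning
  e = suc f
  D = suc e
  -- As `n ≤ 16 * N`, this threshold turns `T * W ≤ n ^ D` into `2 * W ≤ (2 * N) ^ D`, which stops
  -- the growth at side `2 * N`.
  T = 2 * 8 ^ D
  C = 2 ^ (2 + D) * (2 * D) + 6 * D * 16 ^ e
  K₁ = 2 * D * T * b
  K₂ = 32 * D
  K₃ = 16 * 8 ^ f * C
  K = suc (K₁ + K₂ + K₃)
  K₁≤K : K₁ ≤ K
  K₁≤K = m≤n⇒m≤1+n (≤-trans (m≤m+n K₁ K₂) (m≤m+n _ K₃))
  K₂≤K : K₂ ≤ K
  K₂≤K = m≤n⇒m≤1+n (≤-trans (m≤n+m K₂ K₁) (m≤m+n _ K₃))
  K₃≤K : K₃ ≤ K
  K₃≤K = m≤n⇒m≤1+n (m≤n+m K₃ (K₁ + K₂))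
  bounds : (n p : ℕ) → 8 ≤ n → 1 < p → p ≤ n ^ e → (E : Execution n D p) → Execution.W E * b ≤ a * n ^ D →
    ((n ^ e) ^ e ≤ (K * Execution.H E) ^ e * p ^ f) × (Execution.W E ^ e ≤ (K * Execution.H E) ^ D)
  bounds n@(suc k) p@(suc _) 8≤n 1<p p≤ E Wb≤ = by-size (T * W ≤? n ^ D)
    where
    open Execution E
    open Loads E
    q = proj₁ (maxOver-attained load)
    load≡W : load q ≡ W
    load≡W = proj₂ (maxOver-attained load)

    Goal : Set
    Goal = ((n ^ e) ^ e ≤ (K * H) ^ e * p ^ f) × (W ^ e ≤ (K * H) ^ D)

    -- A bound of order `n ^ e` on `H` exceeds both terms, because `p` is positive and `W ≤ n ^ D`.
    large : n ^ D < T * W → Goal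
    large n^d<TW = first , second
      where
      n^e≤KH : n ^ e ≤ K * H
      n^e≤KH = ≤-trans (heavy-processor q {a} {b} {T} load≡W a<b Wb≤ n^d<TW) (*-monoˡ-≤ H K₁≤K)
      first : (n ^ e) ^ e ≤ (K * H) ^ e * p ^ f
      first = ≤-trans (^-monoˡ-≤ e n^e≤KH) (m≤m*n _ (p ^ f) {{m^n≢0 p f}})
      W≤n^d : W ≤ n ^ D
      W≤n^d = *-cancelʳ-≤ W (n ^ D) b {{>-nonZero (≤-<-trans z≤n a<b)}} (begin
        W * b           ≤⟨ Wb≤ ⟩
        a * n ^ D       ≤⟨ *-monoˡ-≤ (n ^ D) (<⇒≤ a<b) ⟩
        b * n ^ D       ≡⟨ *-comm b (n ^ D) ⟩
        n ^ D * b       ∎)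
      second : W ^ e ≤ (K * H) ^ D
      second = begin
        W ^ e           ≤⟨ ^-monoˡ-≤ e W≤n^d ⟩
        (n ^ D) ^ e     ≡⟨ ^-*-assoc n D e ⟩
        n ^ (D * e)     ≡⟨ cong (n ^_) (*-comm D e) ⟩
        n ^ (e * D)     ≡⟨ ^-*-assoc n e D ⟨
        (n ^ e) ^ D     ≤⟨ ^-monoˡ-≤ D n^e≤KH ⟩
        (K * H) ^ D     ∎

    small : T * W ≤ n ^ D → Goal
    small TW≤ = first , second (W ℕₚ.≟ 0)
      where
      2W≤ : 2 * W ≤ n ^ D
      2W≤ = ≤-trans (*-monoˡ-≤ W (m≤m*n 2 (8 ^ D) {{m^n≢0 8 D}})) TW≤
      second : Dec (W ≡ 0) → W ^ e ≤ (K * H) ^ D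
      second (yes W≡0) = ≤-trans (≤-reflexive (cong (_^ e) W≡0)) z≤n
      second (no W≢0)  = ≤-trans (load-bound q load≡W (n≢0⇒n>0 W≢0) 2W≤) (^-monoˡ-≤ D (*-monoˡ-≤ H K₂≤K))
      first : (n ^ e) ^ e ≤ (K * H) ^ e * p ^ f
      first with critical-side {n} {p} f (s≤s z≤n) (s≤s z≤n) p≤ | eighth 8≤n
      ... | j , 8j<n , n^e≤ , m^ep≤ | N , 0<N , 8N≤n , n<8N+8 = begin
        -- Only `f` of the `e` factors `n ^ e` are replaced: this produces `p ^ f`, and the rest is
        -- the `e`-th power of `n * (8 * m) ^ f`.
        (n ^ e) ^ e                                   ≤⟨ *-monoʳ-≤ (n ^ e) (^-monoˡ-≤ f n^e≤) ⟩
        n ^ e * ((8 * m) ^ e * p) ^ f                 ≡⟨ cong (n ^ e *_) (^-distribʳ-* ((8 * m) ^ e) p f) ⟩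
        n ^ e * (((8 * m) ^ e) ^ f * p ^ f)           ≡⟨ *-assoc (n ^ e) _ (p ^ f) ⟨
        n ^ e * ((8 * m) ^ e) ^ f * p ^ f             ≡⟨ cong (λ z → n ^ e * z * p ^ f) (trans (^-*-assoc (8 * m) e f) (trans (cong ((8 * m) ^_) (*-comm e f)) (sym (^-*-assoc (8 * m) f e)))) ⟩
        n ^ e * ((8 * m) ^ f) ^ e * p ^ f             ≡⟨ cong (_* p ^ f) (^-distribʳ-* n ((8 * m) ^ f) e) ⟨
        (n * (8 * m) ^ f) ^ e * p ^ f                 ≤⟨ *-monoˡ-≤ (p ^ f) (^-monoˡ-≤ e scaled) ⟩
        (K * H) ^ e * p ^ f                           ∎
        where
        m = suc j
        -- The common factor 8 in `critical-side` and `eighth` gives `8 * j < n < 8 * suc N`, hence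
        -- `m ≤ suc N`.
        m≤2N : m ≤ 2 * N
        m≤2N = ≤-trans (*-cancelˡ-< 8 j (suc N) (<-trans 8j<n n<8N+8)) (≤-trans (+-monoˡ-≤ N 0<N) (≤-reflexive (cong (N +_) (sym (+-identityʳ N)))))
        n≤16N : n ≤ 16 * N
        n≤16N = ≤-trans (<⇒≤ n<8N+8) (≤-trans (*-monoʳ-≤ 8 (+-monoˡ-≤ N 0<N)) (≤-reflexive (double N)))
          where
          double : ∀ N → 8 * (N + N) ≡ 16 * N
          double = solve-∀
        2W≤[2N]^D : 2 * W ≤ (2 * N) ^ D
        2W≤[2N]^D = *-cancelˡ-≤ (8 ^ D) {{m^n≢0 8 D}} (begin
          8 ^ D * (2 * W)           ≡⟨ *-assoc (8 ^ D) 2 W ⟨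
          8 ^ D * 2 * W             ≡⟨ cong (_* W) (*-comm (8 ^ D) 2) ⟩
          T * W                     ≤⟨ TW≤ ⟩
          n ^ D                     ≤⟨ ^-monoˡ-≤ D n≤16N ⟩
          (16 * N) ^ D              ≡⟨ cong (_^ D) (*-assoc 8 2 N) ⟩
          (8 * (2 * N)) ^ D         ≡⟨ ^-distribʳ-* 8 (2 * N) D ⟩
          8 ^ D * (2 * N) ^ D       ∎)
        diagonal : m ^ f * N ≤ C * H
        diagonal = Diagonal.Along.diagonal-bound E (s≤s z≤n) m≤2N 0<N 8N≤n 2W≤[2N]^D refl (≤-trans m^ep≤ (^-monoˡ-≤ e n≤16N))
        shuffle : ∀ N x y → 16 * N * (x * y) ≡ 16 * x * (y * N)
        shuffle = solve-∀
        scaled : n * (8 * m) ^ f ≤ K * H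
        scaled = begin
          n * (8 * m) ^ f                  ≤⟨ *-monoˡ-≤ ((8 * m) ^ f) n≤16N ⟩
          16 * N * (8 * m) ^ f             ≡⟨ cong (16 * N *_) (^-distribʳ-* 8 m f) ⟩
          16 * N * (8 ^ f * m ^ f)         ≡⟨ shuffle N (8 ^ f) (m ^ f) ⟩
          16 * 8 ^ f * (m ^ f * N)         ≤⟨ *-monoʳ-≤ (16 * 8 ^ f) diagonal ⟩
          16 * 8 ^ f * (C * H)             ≡⟨ *-assoc (16 * 8 ^ f) C H ⟨
          K₃ * H                           ≤⟨ *-monoˡ-≤ H K₃≤K ⟩
          K * H                            ∎

    by-size : Dec (T * W ≤ n ^ D) → Goal
    by-size (yes TW≤) = small TW≤
    by-size (no TW≰)  = large (≰⇒> TW≰)
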